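{- Let $k\geq 1$ be an integer and let $G$ be a graph of order $n$. If \[ \mu(G)>\frac{k-1}{2}+\sqrt{kn+\frac{(k+1)^2}{4}}, \] then $G$ contains $C_{2k+1}$ or $C_{2k+2}$ as a subgraph.
   Context: All graphs are finite and simple. $\mu(G)$ denotes the largest eigenvalue of the adjacency matrix of $G$. $C_r$ denotes the cycle on $r$ vertices. -}

module Defs where

open import Data.Bool.Base using (if_then_else_)
open import Data.Fin.Base using (Fin; toℕ)
import Data.Fin.Properties as Fin
open import Data.Integer.Base using (+_; -[1+_]; +≤+; +<+)
import Data.Integer.Base as ℤ
import Data.Integer.Properties as ℤ
open import Data.Nat.Base using (ℕ; zero; suc; NonZero)
import Data.Nat.Base as ℕ
import Data.Nat.Properties as ℕ
import Data.Nat.Solver as ℕ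
open import Data.Product.Base using (Σ; ∃; _×_; _,_)
open import Data.Rational.Base using (ℚ; mkℚ; 0ℚ; 1ℚ; ½; _/_; ∣_∣; 1/_; toℚᵘ; positive; nonNegative)
import Data.Rational.Base as ℚ
import Data.Rational.Properties as ℚ
open import Data.Rational.Solver using (module +-*-Solver)
open import Data.Rational.Unnormalised.Base using (mkℚᵘ; *≤*; *<*)
import Data.Rational.Unnormalised.Base as ℚᵘ
import Data.Rational.Unnormalised.Properties as ℚᵘ
open import Data.Sum.Base using (_⊎_; inj₁; inj₂; swap)
open import Data.Vec.Functional using (Vector; foldr)
open import Function.Definitions using (Injective)
open import Level using (0ℓ)
open import Relation.Binary.Core using (Rel)
open import Relation.Binary.Definitions using (Decidable; Irreflexive; Symmetric)
open import Relation.Binary.PropositionalEquality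
open import Relation.Nullary using (¬_; does; yes; no; ¬?; contradiction; _×-dec_; _⊎-dec_)

-- Reals are Cauchy sequences of rationals; equality of reals is _≈_, not _≡_.
IsCauchy : (ℕ → ℚ) → Set
IsCauchy x = ∀ ε → 0ℚ ℚ.< ε →
  ∃ λ N → ∀ m n → N ℕ.≤ m → N ℕ.≤ n → ∣ x m ℚ.- x n ∣ ℚ.< ε

record ℝ : Set where
  constructor mkℝ
  field
    seq    : ℕ → ℚ
    cauchy : IsCauchy seq

open ℝ public

infix 4 _≈_ _≤_ _<_ _>_

_≈_ : Rel ℝ 0ℓ
x ≈ y = ∀ ε → 0ℚ ℚ.< ε →
  ∃ λ N → ∀ n → N ℕ.≤ n → ∣ seq x n ℚ.- seq y n ∣ ℚ.< ε

_≤_ : Rel ℝ 0ℓ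
x ≤ y = ∀ ε → 0ℚ ℚ.< ε →
  ∃ λ N → ∀ n → N ℕ.≤ n → seq x n ℚ.< seq y n ℚ.+ ε

_<_ : Rel ℝ 0ℓ
x < y = ∃ λ ε → 0ℚ ℚ.< ε ×
  ∃ λ N → ∀ n → N ℕ.≤ n → seq x n ℚ.+ ε ℚ.< seq y n

_>_ : Rel ℝ 0ℓ
x > y = y < x

private
  <⇒≱ : ∀ {p q} → p ℚ.< q → ¬ (q ℚ.≤ p)
  <⇒≱ p<q q≤p = ℚ.<-irrefl refl (ℚ.<-≤-trans p<q q≤p)

  ≤⇒≯ : ∀ {p q} → p ℚ.≤ q → ¬ (q ℚ.< p)
  ≤⇒≯ p≤q q<p = <⇒≱ q<p p≤q

  0<½*ε : ∀ {ε} → 0ℚ ℚ.< ε → 0ℚ ℚ.< ½ ℚ.* ε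
  0<½*ε {ε} ε>0 = ℚ.positive⁻¹ (½ ℚ.* ε) {{ℚ.pos*pos⇒pos ½ ε {{positive ε>0}}}}

  ½ε+½ε≡ε : ∀ ε → ½ ℚ.* ε ℚ.+ ½ ℚ.* ε ≡ ε
  ½ε+½ε≡ε ε = trans (sym (ℚ.*-distribʳ-+ ε ½ ½)) (ℚ.*-identityˡ ε)

  0<p+q : ∀ p q → 0ℚ ℚ.< p → 0ℚ ℚ.< q → 0ℚ ℚ.< p ℚ.+ q
  0<p+q p q p>0 q>0 = ℚ.positive⁻¹ (p ℚ.+ q)
    {{ℚ.pos+pos⇒pos p {{positive p>0}} q {{positive q>0}}}}

  divide : ∀ {p q} → 0ℚ ℚ.< p → 0ℚ ℚ.< q → ∃ λ r → 0ℚ ℚ.< r × r ℚ.* q ≡ p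
  divide {p} {q} p>0 q>0 = p ℚ.* 1/ q
    , ℚ.positive⁻¹ (p ℚ.* 1/ q) {{ℚ.pos*pos⇒pos p (1/ q)}}
    , trans (ℚ.*-assoc p (1/ q) q)
        (trans (cong (p ℚ.*_) (ℚ.*-inverseˡ q)) (ℚ.*-identityʳ p))
    where
    instance
      p⁺ = positive p>0
      q⁺ = positive q>0
      q≢0 = ℚ.pos⇒nonZero q
      1/q⁺ = ℚ.1/pos⇒pos q

  Bounded : (ℕ → ℚ) → Set
  Bounded x = ∃ λ B → 0ℚ ℚ.< B × ∃ λ N → ∀ n → N ℕ.≤ n → ∣ x n ∣ ℚ.≤ B

  cauchy⇒bounded : ∀ x → IsCauchy x → Bounded x
  cauchy⇒bounded x cx with cx 1ℚ (ℚ.positive⁻¹ 1ℚ)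
  ... | N , h = ∣ x N ∣ ℚ.+ 1ℚ
    , ℚ.positive⁻¹ _ {{ℚ.nonNeg+pos⇒pos ∣ x N ∣ {{ℚ.∣-∣-nonNeg (x N)}} 1ℚ}}
    , N , bound
    where
    open ℚ.≤-Reasoning
    bound : ∀ n → N ℕ.≤ n → ∣ x n ∣ ℚ.≤ ∣ x N ∣ ℚ.+ 1ℚ
    bound n N≤n = begin
      ∣ x n ∣
        ≡⟨ cong ∣_∣ (solve 2 (λ a b → a := b :+ (a :- b)) refl (x n) (x N)) ⟩
      ∣ x N ℚ.+ (x n ℚ.- x N) ∣
        ≤⟨ ℚ.∣p+q∣≤∣p∣+∣q∣ (x N) (x n ℚ.- x N) ⟩
      ∣ x N ∣ ℚ.+ ∣ x n ℚ.- x N ∣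
        ≤⟨ ℚ.+-monoʳ-≤ ∣ x N ∣ (ℚ.<⇒≤ (h n N N≤n ℕ.≤-refl)) ⟩
      ∣ x N ∣ ℚ.+ 1ℚ ∎
      where open +-*-Solver

  const-cauchy : ∀ q → IsCauchy (λ _ → q)
  const-cauchy q ε ε>0 = 0 , λ _ _ _ _ → subst (λ z → ∣ z ∣ ℚ.< ε) (sym (ℚ.+-inverseʳ q)) ε>0

  +-cauchy : ∀ x y → IsCauchy x → IsCauchy y → IsCauchy (λ n → x n ℚ.+ y n)
  +-cauchy x y cx cy ε ε>0 with cx (½ ℚ.* ε) (0<½*ε ε>0) | cy (½ ℚ.* ε) (0<½*ε ε>0)
  ... | M , hx | N , hy = M ℕ.⊔ N , λ m n le₁ le₂ → begin-strict
      ∣ (x m ℚ.+ y m) ℚ.- (x n ℚ.+ y n) ∣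
        ≡⟨ cong ∣_∣ (solve 4 (λ a b c d → (a :+ b) :- (c :+ d) := (a :- c) :+ (b :- d))
             refl (x m) (y m) (x n) (y n)) ⟩
      ∣ (x m ℚ.- x n) ℚ.+ (y m ℚ.- y n) ∣
        ≤⟨ ℚ.∣p+q∣≤∣p∣+∣q∣ (x m ℚ.- x n) (y m ℚ.- y n) ⟩
      ∣ x m ℚ.- x n ∣ ℚ.+ ∣ y m ℚ.- y n ∣
        <⟨ ℚ.+-mono-< (hx m n (ℕ.m⊔n≤o⇒m≤o M N le₁) (ℕ.m⊔n≤o⇒m≤o M N le₂))
                      (hy m n (ℕ.m⊔n≤o⇒n≤o M N le₁) (ℕ.m⊔n≤o⇒n≤o M N le₂)) ⟩
      ½ ℚ.* ε ℚ.+ ½ ℚ.* ε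
        ≡⟨ ½ε+½ε≡ε ε ⟩
      ε ∎
    where
    open ℚ.≤-Reasoning
    open +-*-Solver

  *-split : ∀ a b c d → a ℚ.* b ℚ.- c ℚ.* d ≡ a ℚ.* (b ℚ.- d) ℚ.+ d ℚ.* (a ℚ.- c)
  *-split = solve 4 (λ a b c d → a :* b :- c :* d := a :* (b :- d) :+ d :* (a :- c)) refl
    where open +-*-Solver

  ∣*∣-bound : ∀ {C δ} a b → 0ℚ ℚ.< C → ∣ a ∣ ℚ.≤ C → ∣ b ∣ ℚ.< δ → ∣ a ℚ.* b ∣ ℚ.< δ ℚ.* C
  ∣*∣-bound {C} {δ} a b C>0 ha hb = begin-strict
    ∣ a ℚ.* b ∣     ≡⟨ ℚ.∣p*q∣≡∣p∣*∣q∣ a b ⟩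
    ∣ a ∣ ℚ.* ∣ b ∣ ≤⟨ ℚ.*-monoʳ-≤-nonNeg ∣ b ∣ {{ℚ.∣-∣-nonNeg b}} ha ⟩
    C ℚ.* ∣ b ∣     ≡⟨ ℚ.*-comm C ∣ b ∣ ⟩
    ∣ b ∣ ℚ.* C     <⟨ ℚ.*-monoˡ-<-pos C {{positive C>0}} hb ⟩
    δ ℚ.* C         ∎
    where open ℚ.≤-Reasoning

  *-close : ∀ a b c d {A B δ} → 0ℚ ℚ.< A → 0ℚ ℚ.< B → ∣ a ∣ ℚ.≤ A → ∣ d ∣ ℚ.≤ B →
            ∣ b ℚ.- d ∣ ℚ.< δ → ∣ a ℚ.- c ∣ ℚ.< δ →
            ∣ a ℚ.* b ℚ.- c ℚ.* d ∣ ℚ.< δ ℚ.* (A ℚ.+ B)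
  *-close a b c d {A} {B} {δ} A>0 B>0 ha hd hbd hac = begin-strict
    ∣ a ℚ.* b ℚ.- c ℚ.* d ∣
      ≡⟨ cong ∣_∣ (*-split a b c d) ⟩
    ∣ a ℚ.* (b ℚ.- d) ℚ.+ d ℚ.* (a ℚ.- c) ∣
      ≤⟨ ℚ.∣p+q∣≤∣p∣+∣q∣ (a ℚ.* (b ℚ.- d)) (d ℚ.* (a ℚ.- c)) ⟩
    ∣ a ℚ.* (b ℚ.- d) ∣ ℚ.+ ∣ d ℚ.* (a ℚ.- c) ∣
      <⟨ ℚ.+-mono-< (∣*∣-bound a (b ℚ.- d) A>0 ha hbd) (∣*∣-bound d (a ℚ.- c) B>0 hd hac) ⟩
    δ ℚ.* A ℚ.+ δ ℚ.* B
      ≡⟨ sym (ℚ.*-distribˡ-+ δ A B) ⟩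
    δ ℚ.* (A ℚ.+ B) ∎
    where open ℚ.≤-Reasoning

  *-cauchy : ∀ x y → IsCauchy x → IsCauchy y → IsCauchy (λ n → x n ℚ.* y n)
  *-cauchy x y cx cy ε ε>0 = from-bounds (cauchy⇒bounded x cx) (cauchy⇒bounded y cy)
    where
    Goal = ∃ λ N → ∀ m n → N ℕ.≤ m → N ℕ.≤ n → ∣ x m ℚ.* y m ℚ.- x n ℚ.* y n ∣ ℚ.< ε
    from-bounds : Bounded x → Bounded y → Goal
    from-bounds (A , A>0 , K , hA) (B , B>0 , L , hB) = from-δ (divide ε>0 (0<p+q A B A>0 B>0))
      where
      from-δ : (∃ λ δ → 0ℚ ℚ.< δ × δ ℚ.* (A ℚ.+ B) ≡ ε) → Goal
      from-δ (δ , δ>0 , δ*[A+B]≡ε) = from-moduli (cx δ δ>0) (cy δ δ>0)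
        where
        Modulus : (ℕ → ℚ) → Set
        Modulus z = ∃ λ N → ∀ m n → N ℕ.≤ m → N ℕ.≤ n → ∣ z m ℚ.- z n ∣ ℚ.< δ
        from-moduli : Modulus x → Modulus y → Goal
        from-moduli (M , hx) (N , hy) = (K ℕ.⊔ L) ℕ.⊔ (M ℕ.⊔ N) , λ m n le₁ le₂ →
          let K⊔L≤m = ℕ.m⊔n≤o⇒m≤o (K ℕ.⊔ L) (M ℕ.⊔ N) le₁
              K⊔L≤n = ℕ.m⊔n≤o⇒m≤o (K ℕ.⊔ L) (M ℕ.⊔ N) le₂
              M⊔N≤m = ℕ.m⊔n≤o⇒n≤o (K ℕ.⊔ L) (M ℕ.⊔ N) le₁
              M⊔N≤n = ℕ.m⊔n≤o⇒n≤o (K ℕ.⊔ L) (M ℕ.⊔ N) le₂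
          in subst (∣ x m ℚ.* y m ℚ.- x n ℚ.* y n ∣ ℚ.<_) δ*[A+B]≡ε
            (*-close (x m) (y m) (x n) (y n) {A} {B} {δ} A>0 B>0
              (hA m (ℕ.m⊔n≤o⇒m≤o K L K⊔L≤m)) (hB n (ℕ.m⊔n≤o⇒n≤o K L K⊔L≤n))
              (hy m n (ℕ.m⊔n≤o⇒n≤o M N M⊔N≤m) (ℕ.m⊔n≤o⇒n≤o M N M⊔N≤n))
              (hx m n (ℕ.m⊔n≤o⇒m≤o M N M⊔N≤m) (ℕ.m⊔n≤o⇒m≤o M N M⊔N≤n)))

fromℚ : ℚ → ℝ
fromℚ q = mkℝ (λ _ → q) (const-cauchy q)

0ℝ 1ℝ : ℝ
0ℝ = fromℚ 0ℚ
1ℝ = fromℚ 1ℚ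

infixl 6 _+_
infixl 7 _*_

_+_ : ℝ → ℝ → ℝ
x + y = mkℝ (λ n → seq x n ℚ.+ seq y n) (+-cauchy (seq x) (seq y) (cauchy x) (cauchy y))

_*_ : ℝ → ℝ → ℝ
x * y = mkℝ (λ n → seq x n ℚ.* seq y n) (*-cauchy (seq x) (seq y) (cauchy x) (cauchy y))

-- ⌊√m⌋
isqrt : ℕ → ℕ
isqrt zero    = 0
isqrt (suc m) with suc (isqrt m) ℕ.* suc (isqrt m) ℕ.≤? suc m
... | yes _ = suc (isqrt m)
... | no  _ = isqrt m

isqrt-lower : ∀ m → isqrt m ℕ.* isqrt m ℕ.≤ m
isqrt-lower zero = ℕ.z≤n
isqrt-lower (suc m) with suc (isqrt m) ℕ.* suc (isqrt m) ℕ.≤? suc m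
... | yes p = p
... | no  _ = ℕ.m≤n⇒m≤1+n (isqrt-lower m)

isqrt-upper : ∀ m → m ℕ.< suc (isqrt m) ℕ.* suc (isqrt m)
isqrt-upper zero = ℕ.s≤s ℕ.z≤n
isqrt-upper (suc m) with suc (isqrt m) ℕ.* suc (isqrt m) ℕ.≤? suc m
... | yes _ = ℕ.≤-<-trans (isqrt-upper m)
                (ℕ.*-mono-< (ℕ.n<1+n (suc (isqrt m))) (ℕ.n<1+n (suc (isqrt m))))
... | no ¬p = ℕ.≰⇒> ¬p

-- For q = p/d ≥ 0 the n-th approximation is ⌊√q · d(n+1)⌋ / d(n+1).
√-seq : ℚ → ℕ → ℚ
√-seq (mkℚ (+ p) d-1 _)  n =
  + isqrt (p ℕ.* suc n ℕ.* (suc d-1 ℕ.* suc n)) / (suc d-1 ℕ.* suc n)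
√-seq (mkℚ -[1+ _ ] _ _) n = 0ℚ

private
  0≤a/D : ∀ a D .{{_ : NonZero D}} → 0ℚ ℚ.≤ + a / D
  0≤a/D a D = ℚ.nonNegative⁻¹ (+ a / D) {{ℚ.normalize-nonNeg a D}}

  0≤√-seq : ∀ q n → 0ℚ ℚ.≤ √-seq q n
  0≤√-seq (mkℚ (+ p) d-1 _)  n =
    0≤a/D (isqrt (p ℕ.* suc n ℕ.* (suc d-1 ℕ.* suc n))) (suc d-1 ℕ.* suc n)
  0≤√-seq (mkℚ -[1+ _ ] _ _) n = ℚ.≤-refl

  δ : ℕ → ℚ
  δ n = + 1 / suc n

  toℚᵘ-/ : ∀ a D-1 → toℚᵘ (+ a / suc D-1) ℚᵘ.≃ mkℚᵘ (+ a) D-1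
  toℚᵘ-/ a D-1 = ℚ.toℚᵘ-fromℚᵘ (mkℚᵘ (+ a) D-1)

  sq-mono-≤ : ∀ {a b} → 0ℚ ℚ.≤ a → a ℚ.≤ b → a ℚ.* a ℚ.≤ b ℚ.* b
  sq-mono-≤ {a} {b} 0≤a a≤b = ℚ.≤-trans
    (ℚ.*-monoʳ-≤-nonNeg a {{nonNegative 0≤a}} a≤b)
    (ℚ.*-monoˡ-≤-nonNeg b {{nonNegative (ℚ.≤-trans 0≤a a≤b)}} a≤b)

  /-mono-≤ : ∀ {a b} c e → a ℕ.* suc e ℕ.≤ b ℕ.* suc c → + a / suc c ℚ.≤ + b / suc e
  /-mono-≤ {a} {b} c e h = ℚ.toℚᵘ-cancel-≤
    (ℚᵘ.≤-respʳ-≃ (ℚᵘ.≃-sym (toℚᵘ-/ b e)) (ℚᵘ.≤-respˡ-≃ (ℚᵘ.≃-sym (toℚᵘ-/ a c))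
      (*≤* (subst₂ ℤ._≤_ (ℤ.pos-* a (suc e)) (ℤ.pos-* b (suc c)) (+≤+ h)))))

  square-/ : ∀ a D-1 → toℚᵘ ((+ a / suc D-1) ℚ.* (+ a / suc D-1))
                       ℚᵘ.≃ mkℚᵘ (+ a) D-1 ℚᵘ.* mkℚᵘ (+ a) D-1
  square-/ a D-1 = ℚᵘ.≃-trans (ℚ.toℚᵘ-homo-* (+ a / suc D-1) (+ a / suc D-1))
    (ℚᵘ.*-cong (toℚᵘ-/ a D-1) (toℚᵘ-/ a D-1))

  pos-*₃ : ∀ a b c → + (a ℕ.* b ℕ.* c) ≡ + a ℤ.* + b ℤ.* + c
  pos-*₃ a b c = trans (ℤ.pos-* (a ℕ.* b) c) (cong (ℤ._* + c) (ℤ.pos-* a b))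

  radicand-eq : ∀ p n d → p ℕ.* n ℕ.* (d ℕ.* n) ℕ.* d ≡ p ℕ.* ((d ℕ.* n) ℕ.* (d ℕ.* n))
  radicand-eq = solve 3 (λ p n d → p :* n :* (d :* n) :* d := p :* ((d :* n) :* (d :* n))) refl
    where open ℕ.+-*-Solver

  √-lower : ∀ q n → 0ℚ ℚ.≤ q → √-seq q n ℚ.* √-seq q n ℚ.≤ q
  √-lower q@(mkℚ (+ p) d-1 _) n _ = ℚ.toℚᵘ-cancel-≤
    (ℚᵘ.≤-respˡ-≃ (ℚᵘ.≃-sym (square-/ r _))
      (*≤* (subst₂ ℤ._≤_ (pos-*₃ r r d)  (ℤ.pos-* p (D ℕ.* D)) (+≤+ le))))
    where
    d = suc d-1
    D = d ℕ.* suc n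
    M = p ℕ.* suc n ℕ.* D
    r = isqrt M
    le : r ℕ.* r ℕ.* d ℕ.≤ p ℕ.* (D ℕ.* D)
    le = ℕ.≤-trans (ℕ.*-monoˡ-≤ d (isqrt-lower M)) (ℕ.≤-reflexive (radicand-eq p (suc n) d))
  √-lower q@(mkℚ -[1+ _ ] _ _) n 0≤q = contradiction 0≤q (<⇒≱ (ℚ.negative⁻¹ q))

  √-upper : ∀ q n → q ℚ.< (√-seq q n ℚ.+ δ n) ℚ.* (√-seq q n ℚ.+ δ n)
  √-upper q@(mkℚ (+ p) d-1 _) n = ℚ.<-≤-trans q<t² (sq-mono-≤ (0≤a/D (suc r) D) t≤)
    where
    d = suc d-1
    D = d ℕ.* suc n
    M = p ℕ.* suc n ℕ.* D
    r = isqrt M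
    lt : p ℕ.* (D ℕ.* D) ℕ.< suc r ℕ.* suc r ℕ.* d
    lt = ℕ.≤-<-trans (ℕ.≤-reflexive (sym (radicand-eq p (suc n) d)))
           (ℕ.*-monoˡ-< d (isqrt-upper M))
    q<t² : q ℚ.< (+ suc r / D) ℚ.* (+ suc r / D)
    q<t² = ℚ.toℚᵘ-cancel-<
      (ℚᵘ.<-respʳ-≃ (ℚᵘ.≃-sym (square-/ (suc r) _))
        (*<* (subst₂ ℤ._<_ (ℤ.pos-* p (D ℕ.* D)) (pos-*₃ (suc r) (suc r) d) (+<+ lt))))
    split : + suc r / D ≡ + r / D ℚ.+ + 1 / D
    split = ℚ.toℚᵘ-injective (ℚᵘ.≃-trans (toℚᵘ-/ (suc r) _) (ℚᵘ.≃-sym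
      (ℚᵘ.≃-trans (ℚ.toℚᵘ-homo-+ (+ r / D) (+ 1 / D))
        (ℚᵘ.≃-trans (ℚᵘ.+-cong (toℚᵘ-/ r _) (toℚᵘ-/ 1 _)) (ℚᵘ.*≡* eq)))))
      where
      eqℕ : (r ℕ.* D ℕ.+ 1 ℕ.* D) ℕ.* D ≡ suc r ℕ.* (D ℕ.* D)
      eqℕ = solve 2 (λ a b → (a :* b :+ con 1 :* b) :* b := (con 1 :+ a) :* (b :* b)) refl r D
        where open ℕ.+-*-Solver
      eq : (+ r ℤ.* + D ℤ.+ + 1 ℤ.* + D) ℤ.* + D ≡ + suc r ℤ.* + (D ℕ.* D)
      eq = trans (cong (ℤ._* + D) (cong₂ ℤ._+_ (sym (ℤ.pos-* r D)) (sym (ℤ.pos-* 1 D))))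
        (trans (sym (ℤ.pos-* (r ℕ.* D ℕ.+ 1 ℕ.* D) D))
        (trans (cong +_ eqℕ) (ℤ.pos-* (suc r) (D ℕ.* D))))
    t≤ : + suc r / D ℚ.≤ + r / D ℚ.+ δ n
    t≤ = ℚ.≤-trans (ℚ.≤-reflexive split) (ℚ.+-monoʳ-≤ (+ r / D)
           (/-mono-≤ {1} {1} _ n (ℕ.*-monoʳ-≤ 1 (ℕ.m≤n*m (suc n) d))))
  √-upper q@(mkℚ -[1+ _ ] _ _) n = ℚ.<-≤-trans (ℚ.negative⁻¹ q)
    (ℚ.≤-trans (ℚ.≤-reflexive (sym (ℚ.*-zeroˡ 0ℚ)))
      (sq-mono-≤ ℚ.≤-refl (subst (0ℚ ℚ.≤_) (sym (ℚ.+-identityˡ (δ n))) (0≤a/D 1 (suc n)))))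

  sq-cancel-< : ∀ {a b} → 0ℚ ℚ.≤ b → a ℚ.* a ℚ.< b ℚ.* b → a ℚ.< b
  sq-cancel-< 0≤b h = ℚ.≰⇒> λ b≤a → <⇒≱ h (sq-mono-≤ 0≤b b≤a)

  0≤√-seq+δ : ∀ q n → 0ℚ ℚ.≤ √-seq q n ℚ.+ δ n
  0≤√-seq+δ q n = ℚ.nonNegative⁻¹ _
    {{ℚ.nonNeg+nonNeg⇒nonNeg (√-seq q n) {{nonNegative (0≤√-seq q n)}}
                             (δ n) {{ℚ.normalize-nonNeg 1 (suc n)}}}}

  √-close : ∀ q m n → √-seq q m ℚ.< √-seq q n ℚ.+ δ n
  √-close q@(mkℚ (+ p) d-1 _) m n = sq-cancel-< (0≤√-seq+δ q n)
    (ℚ.≤-<-trans (√-lower q m (ℚ.nonNegative⁻¹ q)) (√-upper q n))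
  √-close q@(mkℚ -[1+ _ ] _ _) m n =
    subst (0ℚ ℚ.<_) (sym (ℚ.+-identityˡ (δ n)))
      (ℚ.positive⁻¹ (δ n) {{ℚ.normalize-pos 1 (suc n)}})

  δ-anti : ∀ {m n} → m ℕ.≤ n → δ n ℚ.≤ δ m
  δ-anti {m} {n} m≤n = /-mono-≤ {1} {1} n m (ℕ.*-monoʳ-≤ 1 (ℕ.s≤s m≤n))

  δ-archimedean : ∀ ε → 0ℚ ℚ.< ε → ∃ λ N → δ N ℚ.< ε
  δ-archimedean (mkℚ (+ suc p) d-1 _) _ = suc d-1 , ℚ.toℚᵘ-cancel-<
    (ℚᵘ.<-respˡ-≃ (ℚᵘ.≃-sym (toℚᵘ-/ 1 (suc d-1)))
      (*<* (subst₂ ℤ._<_ (ℤ.pos-* 1 (suc d-1)) (ℤ.pos-* (suc p) (2 ℕ.+ d-1)) (+<+ lt))))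
    where
    lt : 1 ℕ.* suc d-1 ℕ.< suc p ℕ.* (2 ℕ.+ d-1)
    lt = ℕ.<-≤-trans (ℕ.*-monoʳ-< 1 (ℕ.n<1+n (suc d-1)))
           (ℕ.*-monoˡ-≤ (2 ℕ.+ d-1) (ℕ.s≤s (ℕ.z≤n {p})))
  δ-archimedean (mkℚ (+ 0) _ _) ε>0 = contradiction ε>0 (≤⇒≯ (ℚ.nonPositive⁻¹ _))
  δ-archimedean q@(mkℚ -[1+ _ ] _ _) ε>0 = contradiction ε>0 (≤⇒≯ (ℚ.nonPositive⁻¹ q))

  ∣a-b∣< : ∀ {a b ε} → a ℚ.< b ℚ.+ ε → b ℚ.< a ℚ.+ ε → ∣ a ℚ.- b ∣ ℚ.< ε
  ∣a-b∣< {a} {b} {ε} a<b+ε b<a+ε with ℚ.∣p∣≡p∨∣p∣≡-p (a ℚ.- b)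
  ... | inj₁ eq = begin-strict
      ∣ a ℚ.- b ∣       ≡⟨ eq ⟩
      a ℚ.- b           <⟨ ℚ.+-monoˡ-< (ℚ.- b) a<b+ε ⟩
      (b ℚ.+ ε) ℚ.- b   ≡⟨ solve 2 (λ b e → (b :+ e) :- b := e) refl b ε ⟩
      ε                 ∎
    where
    open ℚ.≤-Reasoning
    open +-*-Solver
  ... | inj₂ eq = begin-strict
      ∣ a ℚ.- b ∣       ≡⟨ eq ⟩
      ℚ.- (a ℚ.- b)     ≡⟨ solve 2 (λ a b → :- (a :- b) := b :- a) refl a b ⟩
      b ℚ.- a           <⟨ ℚ.+-monoˡ-< (ℚ.- a) b<a+ε ⟩
      (a ℚ.+ ε) ℚ.- a   ≡⟨ solve 2 (λ b e → (b :+ e) :- b := e) refl a ε ⟩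
      ε                 ∎
    where
    open ℚ.≤-Reasoning
    open +-*-Solver

  √-cauchy : ∀ q → IsCauchy (√-seq q)
  √-cauchy q ε ε>0 = from-N (δ-archimedean ε ε>0)
    where
    from-N : (∃ λ N → δ N ℚ.< ε) →
             ∃ λ N → ∀ m n → N ℕ.≤ m → N ℕ.≤ n → ∣ √-seq q m ℚ.- √-seq q n ∣ ℚ.< ε
    from-N (N , δN<ε) = N , λ m n N≤m N≤n →
      ∣a-b∣< {√-seq q m} {√-seq q n} (within m n N≤n) (within n m N≤m)
      where
      within : ∀ m n → N ℕ.≤ n → √-seq q m ℚ.< √-seq q n ℚ.+ ε
      within m n N≤n = ℚ.<-trans (√-close q m n)
        (ℚ.+-monoʳ-< (√-seq q n) (ℚ.≤-<-trans (δ-anti N≤n) δN<ε))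

  s²-close : ∀ s d {q S η ε} → 0ℚ ℚ.≤ d → d ℚ.≤ 1ℚ → s ℚ.≤ S → 0ℚ ℚ.< S ℚ.+ S ℚ.+ 1ℚ →
             d ℚ.< η → η ℚ.* (S ℚ.+ S ℚ.+ 1ℚ) ≡ ε →
             q ℚ.< (s ℚ.+ d) ℚ.* (s ℚ.+ d) → q ℚ.< s ℚ.* s ℚ.+ ε
  s²-close s d {q} {S} {η} {ε} 0≤d d≤1 s≤S W>0 d<η ηW≡ε q< = begin-strict
    q
      <⟨ q< ⟩
    (s ℚ.+ d) ℚ.* (s ℚ.+ d)
      ≡⟨ solve 2 (λ s d → (s :+ d) :* (s :+ d) := s :* s :+ d :* (s :+ s :+ d)) refl s d ⟩
    s ℚ.* s ℚ.+ d ℚ.* (s ℚ.+ s ℚ.+ d)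
      ≤⟨ ℚ.+-monoʳ-≤ (s ℚ.* s) (ℚ.*-monoˡ-≤-nonNeg d {{nonNegative 0≤d}}
           (ℚ.+-mono-≤ (ℚ.+-mono-≤ s≤S s≤S) d≤1)) ⟩
    s ℚ.* s ℚ.+ d ℚ.* (S ℚ.+ S ℚ.+ 1ℚ)
      <⟨ ℚ.+-monoʳ-< (s ℚ.* s) (ℚ.*-monoˡ-<-pos (S ℚ.+ S ℚ.+ 1ℚ) {{positive W>0}} d<η) ⟩
    s ℚ.* s ℚ.+ η ℚ.* (S ℚ.+ S ℚ.+ 1ℚ)
      ≡⟨ cong (s ℚ.* s ℚ.+_) ηW≡ε ⟩
    s ℚ.* s ℚ.+ ε ∎
    where
    open ℚ.≤-Reasoning
    open +-*-Solver

  0<W : ∀ q → let S = √-seq q 0 ℚ.+ δ 0 in 0ℚ ℚ.< S ℚ.+ S ℚ.+ 1ℚ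
  0<W q = ℚ.positive⁻¹ (S ℚ.+ S ℚ.+ 1ℚ)
    {{ℚ.nonNeg+pos⇒pos (S ℚ.+ S) {{ℚ.nonNeg+nonNeg⇒nonNeg S S}} 1ℚ}}
    where
    S = √-seq q 0 ℚ.+ δ 0
    instance S⁰ = nonNegative (0≤√-seq+δ q 0)

-- √ q = 0 for q < 0.
√ : ℚ → ℝ
√ q = mkℝ (√-seq q) (√-cauchy q)

√-nonNegative : ∀ q → 0ℝ ≤ √ q
√-nonNegative q ε ε>0 = 0 , λ n _ → ℚ.<-≤-trans ε>0
  (ℚ.≤-trans (ℚ.≤-reflexive (sym (ℚ.+-identityˡ ε))) (ℚ.+-monoˡ-≤ ε (0≤√-seq q n)))

√-square : ∀ q → 0ℚ ℚ.≤ q → √ q * √ q ≈ fromℚ q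
√-square q 0≤q ε ε>0 = from-η (divide ε>0 (0<W q))
  where
  S = √-seq q 0 ℚ.+ δ 0
  Goal = ∃ λ N → ∀ n → N ℕ.≤ n → ∣ √-seq q n ℚ.* √-seq q n ℚ.- q ∣ ℚ.< ε
  lower : ∀ n → √-seq q n ℚ.* √-seq q n ℚ.< q ℚ.+ ε
  lower n = ℚ.≤-<-trans (√-lower q n 0≤q)
    (subst (ℚ._< q ℚ.+ ε) (ℚ.+-identityʳ q) (ℚ.+-monoʳ-< q ε>0))
  from-η : (∃ λ η → 0ℚ ℚ.< η × η ℚ.* (S ℚ.+ S ℚ.+ 1ℚ) ≡ ε) → Goal
  from-η (η , η>0 , ηW≡ε) = from-N (δ-archimedean η η>0)
    where
    from-N : (∃ λ N → δ N ℚ.< η) → Goal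
    from-N (N , δN<η) = N , λ n N≤n → ∣a-b∣< {√-seq q n ℚ.* √-seq q n} {q} (lower n)
      (s²-close (√-seq q n) (δ n) {q} {S} (0≤a/D 1 (suc n)) (δ-anti {0} {n} ℕ.z≤n)
        (ℚ.<⇒≤ (√-close q n 0)) (0<W q) (ℚ.≤-<-trans (δ-anti N≤n) δN<η) ηW≡ε (√-upper q n))

Matrix : ℕ → Set
Matrix n = Fin n → Fin n → ℝ

infixr 7 _*ᵥ_ _·ᵥ_
infix  4 _≈ᵥ_

_≈ᵥ_ : ∀ {n} → Rel (Vector ℝ n) 0ℓ
x ≈ᵥ y = ∀ i → x i ≈ y i

0ᵥ : ∀ {n} → Vector ℝ n
0ᵥ _ = 0ℝ

_·ᵥ_ : ∀ {n} → ℝ → Vector ℝ n → Vector ℝ n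
(c ·ᵥ x) i = c * x i

_*ᵥ_ : ∀ {n} → Matrix n → Vector ℝ n → Vector ℝ n
(A *ᵥ x) i = foldr _+_ 0ℝ (λ j → A i j * x j)

IsEigenvalue : ∀ {n} → Matrix n → ℝ → Set
IsEigenvalue {n} A c = Σ (Vector ℝ n) λ x → ¬ (x ≈ᵥ 0ᵥ) × A *ᵥ x ≈ᵥ c ·ᵥ x

IsLargestEigenvalue : ∀ {n} → Matrix n → ℝ → Set
IsLargestEigenvalue A μ = IsEigenvalue A μ × (∀ c → IsEigenvalue A c → c ≤ μ)

record Graph (n : ℕ) : Set₁ where
  field
    Adj        : Rel (Fin n) 0ℓ
    adj?       : Decidable Adj
    adj-sym    : Symmetric Adj
    adj-irrefl : Irreflexive _≡_ Adj

adjacencyMatrix : ∀ {n} → Graph n → Matrix n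
adjacencyMatrix G i j = if does (Graph.adj? G i j) then 1ℝ else 0ℝ

-- H is isomorphic to a (not necessarily induced) subgraph of G.
Contains : ∀ {n m} → Graph n → Graph m → Set
Contains {n} {m} G H = Σ (Fin m → Fin n) λ f →
  Injective _≡_ _≡_ f × (∀ {i j} → Graph.Adj H i j → Graph.Adj G (f i) (f j))

-- j follows i in the cyclic order 0, 1, …, r - 1, 0.
Next : ∀ {r} → Rel (Fin r) 0ℓ
Next {r} i j = toℕ j ≡ suc (toℕ i) ⊎ (suc (toℕ i) ≡ r × toℕ j ≡ 0)

-- The condition i ≢ j only matters for r = 1, where it excludes a loop.
C : ∀ r → Graph r
C r = record
  { Adj        = λ i j → i ≢ j × (Next i j ⊎ Next j i)
  ; adj?       = λ i j → ¬? (i Fin.≟ j) ×-dec (next? i j ⊎-dec next? j i)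
  ; adj-sym    = λ (i≢j , e) → ≢-sym i≢j , swap e
  ; adj-irrefl = λ i≡j (i≢j , _) → i≢j i≡j
  }
  where
  next? : Decidable (Next {r})
  next? i j = (toℕ j ℕ.≟ suc (toℕ i)) ⊎-dec ((suc (toℕ i) ℕ.≟ r) ×-dec (toℕ j ℕ.≟ 0))

{-# OPTIONS --safe #-}
module Submission where

-- Fix a vertex u, put A = N(u) and B = the other vertices, and delete u together with all edges
-- inside B.  A path of order 2k or 2k + 1 with both ends in A closes through u to a C_{2k+1} or a
-- C_{2k+2}.  If there is no such path, then Σ_{v ∈ A} d(v) ≤ (2k - 2)|A| + k|B| in the remaining
-- graph: repeatedly remove a vertex of A of degree < k or a vertex of B of degree ≤ k; when there
-- is none left, a longest path closes up (as in Dirac's theorem) to a cycle spanning a component,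
-- and a component that small satisfies the bound.
--
-- Adding u back gives Σ_{v ~ u} d(v) ≤ (k - 1) d(u) + kn for every u, that is, M²1 ≤ (k - 1)M1 + kn1
-- for the adjacency matrix M.  For t > 0 with (k - 1 + t)t ≥ kn and ρ = k - 1 + t, the positive
-- vector w = M1 + t1 then satisfies Mw ≤ ρw.  If Mx = μx, pairing μ|x| ≤ M|x| with w yields
-- (μ - ρ)⟨w,|x|⟩ ≤ 0, so x = 0 as soon as μ > ρ.  No Perron vector is needed.

open import Algebra.Bundles using (CommutativeRing)
import Algebra.Properties.Semiring.Sum as SemiringSum
open import Data.Bool.Base using (true; false; if_then_else_)
open import Data.Empty using (⊥-elim)
open import Data.Fin.Base using (Fin; zero; suc; toℕ)
import Data.Fin.Properties as Fin
open import Data.Integer.Base as ℤ using (+_)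
import Data.Integer.Properties as ℤ
open import Data.List.Base using (List; []; _∷_; _++_; length; map; reverse; lookup; allFin; tabulate)
open import Data.List.Membership.Propositional using (_∈_; find; lose)
open import Data.List.Membership.Propositional.Properties using (∈-∃++; ∈-++⁺ˡ; ∈-lookup)
import Data.List.Properties as List
open import Data.List.Relation.Binary.Permutation.Propositional using (_↭_; refl; prep; swap; trans; ↭-sym; ↭-trans; ↭-reflexive; ↭⇒↭ₛ)
import Data.List.Relation.Binary.Permutation.Propositional.Properties as ↭
import Data.List.Relation.Binary.Permutation.Setoid.Properties as ↭ₛ
open import Data.List.Relation.Unary.All as All using (All; []; _∷_)
import Data.List.Relation.Unary.All.Properties as All
open import Data.List.Relation.Unary.AllPairs using ([]; _∷_)
open import Data.List.Relation.Unary.Any using (Any; here; there; any?)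
open import Data.List.Relation.Unary.Unique.Propositional using (Unique)
import Data.List.Relation.Unary.Unique.Propositional.Properties as Unique
open import Data.Nat.Base as ℕ using (ℕ; zero; suc; z≤n; s≤s)
open import Data.Nat.ListAction using (sum)
open import Data.Nat.ListAction.Properties using (sum-↭; sum-++)
import Data.Nat.Properties as ℕ
open import Data.Nat.Solver using (module +-*-Solver)
open import Data.Product.Base using (∃; ∃₂; _×_; _,_; proj₁)
open import Data.Rational.Base as ℚ using (ℚ; 0ℚ; 1ℚ; _/_; ∣_∣; 1/_; toℚᵘ; positive; nonNegative)
import Data.Rational.Properties as ℚ
import Data.Rational.Solver as ℚ
open import Data.Rational.Unnormalised.Base as ℚᵘ using (mkℚᵘ)
import Data.Rational.Unnormalised.Properties as ℚᵘ
open import Data.Sum.Base as Sum using (_⊎_; inj₁; inj₂)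
open import Data.Vec.Functional using (foldr)
open import Function.Definitions using (Injective)
open import Level using (0ℓ)
open import Relation.Binary.Core using (Rel; _⇒_)
open import Relation.Binary.Definitions using (Decidable; Symmetric; tri<; tri≈; tri>)
open import Relation.Binary.PropositionalEquality as ≡ using (_≡_; _≢_; refl; sym; cong; cong₂; subst; subst₂; setoid)
open import Relation.Nullary using (¬_; Dec; yes; no; does; contradiction; ¬?; _×-dec_; _⊎-dec_)
open import Relation.Unary using (Pred)
import Relation.Unary as U
open import Defs

-- Sums over lists and 0-1 indicators of decidable propositions.

∑ : {V : Set} → (V → ℕ) → List V → ℕ
∑ f vs = sum (map f vs)

[_]₁ : {P : Set} → Dec P → ℕ
[ P? ]₁ = if does P? then 1 else 0

[_]₀ : {P : Set} → Dec P → ℕ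
[ P? ]₀ = if does P? then 0 else 1

[]₁≤1 : {P : Set} (P? : Dec P) → [ P? ]₁ ℕ.≤ 1
[]₁≤1 (yes _) = ℕ.≤-refl
[]₁≤1 (no _)  = z≤n

[]₀≤1 : {P : Set} (P? : Dec P) → [ P? ]₀ ℕ.≤ 1
[]₀≤1 (yes _) = z≤n
[]₀≤1 (no _)  = ℕ.≤-refl

[]₁-⊎ : {P Q R : Set} (P? : Dec P) (Q? : Dec Q) (R? : Dec R) → (P → Q ⊎ R) →
       [ P? ]₁ ℕ.≤ [ Q? ]₁ ℕ.+ [ R? ]₁
[]₁-⊎ (no _)  _       _       _ = z≤n
[]₁-⊎ (yes _) (yes _) _       _ = s≤s z≤n
[]₁-⊎ (yes _) (no _)  (yes _) _ = ℕ.≤-refl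
[]₁-⊎ (yes p) (no ¬q) (no ¬r) f with f p
... | inj₁ q = contradiction q ¬q
... | inj₂ r = contradiction r ¬r

[]₁-* : {P : Set} (P? : Dec P) {m n : ℕ} → (P → m ℕ.≤ n ℕ.+ 1) →
       [ P? ]₁ ℕ.* m ℕ.≤ [ P? ]₁ ℕ.* n ℕ.+ [ P? ]₁
[]₁-* (no _)          _ = z≤n
[]₁-* (yes p) {m} {n} f rewrite ℕ.+-identityʳ m | ℕ.+-identityʳ n = f p

module _ {V : Set} where

  ∑-↭ : (f : V → ℕ) {vs ws : List V} → vs ↭ ws → ∑ f vs ≡ ∑ f ws
  ∑-↭ f p = sum-↭ (↭.map⁺ f p)

  ∑-++ : (f : V → ℕ) (vs ws : List V) → ∑ f (vs ++ ws) ≡ ∑ f vs ℕ.+ ∑ f ws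
  ∑-++ f vs ws = ≡.trans (cong sum (List.map-++ f vs ws)) (sum-++ (map f vs) (map f ws))

  ∑-mono-≤ : {f g : V → ℕ} → (∀ v → f v ℕ.≤ g v) → ∀ vs → ∑ f vs ℕ.≤ ∑ g vs
  ∑-mono-≤ f≤g []       = z≤n
  ∑-mono-≤ f≤g (v ∷ vs) = ℕ.+-mono-≤ (f≤g v) (∑-mono-≤ f≤g vs)

  ∑-distrib-+ : (f g : V → ℕ) → ∀ vs → ∑ (λ v → f v ℕ.+ g v) vs ≡ ∑ f vs ℕ.+ ∑ g vs
  ∑-distrib-+ f g []       = refl
  ∑-distrib-+ f g (v ∷ vs) rewrite ∑-distrib-+ f g vs =
    solve 4 (λ a b c d → a :+ b :+ (c :+ d) := a :+ c :+ (b :+ d)) refl (f v) (g v) (∑ f vs) (∑ g vs)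
    where open +-*-Solver

  ∑-distribˡ-* : ∀ c (f : V → ℕ) vs → ∑ (λ v → c ℕ.* f v) vs ≡ c ℕ.* ∑ f vs
  ∑-distribˡ-* c f []       = sym (ℕ.*-zeroʳ c)
  ∑-distribˡ-* c f (v ∷ vs) = ≡.trans (cong (c ℕ.* f v ℕ.+_) (∑-distribˡ-* c f vs))
    (sym (ℕ.*-distribˡ-+ c (f v) (∑ f vs)))

  ∑-cong : {f g : V → ℕ} → (∀ v → f v ≡ g v) → ∀ vs → ∑ f vs ≡ ∑ g vs
  ∑-cong f≡g vs = cong sum (List.map-cong f≡g vs)

  Unique-↭ : {vs ws : List V} → vs ↭ ws → Unique vs → Unique ws
  Unique-↭ p = ↭ₛ.Unique-resp-↭ (setoid V) (↭⇒↭ₛ p)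

  Unique-++⁻ˡ : (vs : List V) {ws : List V} → Unique (vs ++ ws) → Unique vs
  Unique-++⁻ˡ []       _        = []
  Unique-++⁻ˡ (v ∷ vs) (px ∷ u) = All.++⁻ˡ vs px ∷ Unique-++⁻ˡ vs u

  Any-∃++ : {P : Pred V 0ℓ} {vs : List V} → Any P vs →
            ∃ λ v → ∃₂ λ as bs → P v × vs ≡ as ++ v ∷ bs
  Any-∃++ any with find any
  ... | v , v∈vs , Pv with ∈-∃++ v∈vs
  ... | as , bs , eq = v , as , bs , Pv , eq

-- Paths, and the degree sum over A within a list of vertices.

data Path {V : Set} (E : Rel V 0ℓ) : V → V → List V → Set where
  [_] : ∀ x → Path E x x (x ∷ [])
  _∷_ : ∀ {x y z vs} → E x y → Path E y z vs → Path E x z (x ∷ vs)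

module PathLemma {V : Set} (E : Rel V 0ℓ) (E? : Decidable E) (E-sym : Symmetric E)
  (E-irrefl : ∀ {v} → ¬ E v v) (A : Pred V 0ℓ) (A? : U.Decidable A)
  (indep : ∀ {v w} → E v w → A v ⊎ A w) (j : ℕ) where

  -- Working with `j = k - 1` lets the coefficient `2k - 2` be written `2 * j`, without truncated
  -- subtraction.
  k K : ℕ
  k = suc j
  K = 2 ℕ.* k

  e : V → V → ℕ
  e v w = [ E? v w ]₁

  α β : V → ℕ
  α v = [ A? v ]₁
  β v = [ A? v ]₀

  h : V → V → ℕ
  h v w = e v w ℕ.* (α v ℕ.+ α w)

  -- T vs is the sum of the degrees, within vs, of the vertices of vs in A, organised as a sum over
  -- unordered pairs so that it splits along vs = v ∷ ws and vs = ws ++ ws′ (see T≡∑α*∑e).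
  T : List V → ℕ
  T []       = 0
  T (v ∷ vs) = ∑ (h v) vs ℕ.+ T vs

  -- The upper bound aimed at for `T`. It is additive over vertices, so a removed vertex or a
  -- split-off component can be charged for its own share.
  W : List V → ℕ
  W vs = 2 ℕ.* j ℕ.* ∑ α vs ℕ.+ k ℕ.* ∑ β vs

  e-irrefl : ∀ v → e v v ≡ 0
  e-irrefl v with E? v v
  ... | yes p = contradiction p E-irrefl
  ... | no  _ = refl

  e-sym : ∀ v w → e v w ≡ e w v
  e-sym v w with E? v w | E? w v
  ... | yes _ | yes _ = refl
  ... | yes p | no ¬p = contradiction (E-sym p) ¬p
  ... | no ¬p | yes p = contradiction (E-sym p) ¬p
  ... | no _  | no _  = refl

  h-sym : ∀ v w → h v w ≡ h w v
  h-sym v w = cong₂ ℕ._*_ (e-sym v w) (ℕ.+-comm (α v) (α w))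

  ¬Any⇒∑e≡0 : ∀ v R → ¬ Any (E v) R → ∑ (e v) R ≡ 0
  ¬Any⇒∑e≡0 v []      _  = refl
  ¬Any⇒∑e≡0 v (r ∷ R) ¬a with E? v r
  ... | yes p = contradiction (here p) ¬a
  ... | no  _ = ¬Any⇒∑e≡0 v R (λ a → ¬a (there a))

  ¬Any⇒∑h≡0 : ∀ v R → ¬ Any (E v) R → ∑ (h v) R ≡ 0
  ¬Any⇒∑h≡0 v []      _  = refl
  ¬Any⇒∑h≡0 v (r ∷ R) ¬a with E? v r
  ... | yes p = contradiction (here p) ¬a
  ... | no  _ = ¬Any⇒∑h≡0 v R (λ a → ¬a (there a))

  T-↭ : ∀ {vs ws} → vs ↭ ws → T vs ≡ T ws
  T-↭ refl        = refl
  T-↭ (prep x p)  = cong₂ ℕ._+_ (∑-↭ (h x) p) (T-↭ p)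
  T-↭ (trans p q) = ≡.trans (T-↭ p) (T-↭ q)
  T-↭ (swap {xs} {ys} x y p)
    rewrite ∑-↭ (h x) p | ∑-↭ (h y) p | T-↭ p | h-sym x y =
    solve 4 (λ a b c d → a :+ b :+ (c :+ d) := a :+ c :+ (b :+ d)) refl (h y x) (∑ (h x) ys) (∑ (h y) ys) (T ys)
    where open +-*-Solver

  T-++ : ∀ vs ws → T (vs ++ ws) ≡ ∑ (λ v → ∑ (h v) ws) vs ℕ.+ (T vs ℕ.+ T ws)
  T-++ []       ws = refl
  T-++ (v ∷ vs) ws rewrite ∑-++ (h v) vs ws | T-++ vs ws =
    solve 5 (λ a b c d f → a :+ b :+ (c :+ (d :+ f)) := b :+ c :+ (a :+ d :+ f)) refl
      (∑ (h v) vs) (∑ (h v) ws) (∑ (λ v → ∑ (h v) ws) vs) (T vs) (T ws)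
    where open +-*-Solver

  T≡∑α*∑e : ∀ vs → T vs ≡ ∑ (λ v → α v ℕ.* ∑ (e v) vs) vs
  T≡∑α*∑e []       = refl
  T≡∑α*∑e (v ∷ vs) = begin
    ∑ (h v) vs ℕ.+ T vs
      ≡⟨ cong₂ ℕ._+_ split (T≡∑α*∑e vs) ⟩
    α v ℕ.* ∑ (e v) vs ℕ.+ ∑ (λ w → α w ℕ.* e w v) vs ℕ.+ ∑ (λ w → α w ℕ.* ∑ (e w) vs) vs
      ≡⟨ ℕ.+-assoc (α v ℕ.* ∑ (e v) vs) _ _ ⟩
    α v ℕ.* ∑ (e v) vs ℕ.+ (∑ (λ w → α w ℕ.* e w v) vs ℕ.+ ∑ (λ w → α w ℕ.* ∑ (e w) vs) vs)
      ≡⟨ cong₂ ℕ._+_ (cong (λ z → α v ℕ.* (z ℕ.+ ∑ (e v) vs)) (e-irrefl v)) merge ⟨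
    α v ℕ.* ∑ (e v) (v ∷ vs) ℕ.+ ∑ (λ w → α w ℕ.* ∑ (e w) (v ∷ vs)) vs ∎
    where
    open ≡.≡-Reasoning
    h≡ : ∀ w → h v w ≡ α v ℕ.* e v w ℕ.+ α w ℕ.* e w v
    h≡ w rewrite e-sym w v =
      solve 3 (λ x a b → x :* (a :+ b) := a :* x :+ b :* x) refl (e v w) (α v) (α w)
      where open +-*-Solver
    split : ∑ (h v) vs ≡ α v ℕ.* ∑ (e v) vs ℕ.+ ∑ (λ w → α w ℕ.* e w v) vs
    split = ≡.trans (∑-cong h≡ vs) (≡.trans (∑-distrib-+ _ _ vs)
      (cong (ℕ._+ ∑ (λ w → α w ℕ.* e w v) vs) (∑-distribˡ-* (α v) (e v) vs)))
    merge : ∑ (λ w → α w ℕ.* ∑ (e w) (v ∷ vs)) vs ≡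
            ∑ (λ w → α w ℕ.* e w v) vs ℕ.+ ∑ (λ w → α w ℕ.* ∑ (e w) vs) vs
    merge = ≡.trans (∑-cong (λ w → ℕ.*-distribˡ-+ (α w) (e w v) (∑ (e w) vs)) vs) (∑-distrib-+ _ _ vs)

  ∑α+∑β≡length : ∀ vs → ∑ α vs ℕ.+ ∑ β vs ≡ length vs
  ∑α+∑β≡length []       = refl
  ∑α+∑β≡length (v ∷ vs) with A? v
  ... | yes _ = cong suc (∑α+∑β≡length vs)
  ... | no  _ = ≡.trans (ℕ.+-suc (∑ α vs) (∑ β vs)) (cong suc (∑α+∑β≡length vs))

  W-↭ : ∀ {vs ws} → vs ↭ ws → W vs ≡ W ws
  W-↭ p = cong₂ (λ a b → 2 ℕ.* j ℕ.* a ℕ.+ k ℕ.* b) (∑-↭ α p) (∑-↭ β p)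

  W-++ : ∀ vs ws → W (vs ++ ws) ≡ W vs ℕ.+ W ws
  W-++ vs ws rewrite ∑-++ α vs ws | ∑-++ β vs ws =
    solve 6 (λ x y a b c d → x :* (a :+ b) :+ y :* (c :+ d) := x :* a :+ y :* c :+ (x :* b :+ y :* d)) refl
      (2 ℕ.* j) k (∑ α vs) (∑ α ws) (∑ β vs) (∑ β ws)
    where open +-*-Solver

  -- A vertex of A has at most `length vs - 1` neighbours in `vs`; adding `∑ α vs` on the left
  -- avoids the subtraction.
  T+∑α≤length*∑α : ∀ vs → T vs ℕ.+ ∑ α vs ℕ.≤ length vs ℕ.* ∑ α vs
  T+∑α≤length*∑α []       = z≤n
  T+∑α≤length*∑α (v ∷ vs) = begin
    ∑ (h v) vs ℕ.+ T vs ℕ.+ (α v ℕ.+ a)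
      ≤⟨ ℕ.+-monoˡ-≤ (α v ℕ.+ a) (ℕ.+-monoˡ-≤ (T vs) (∑h≤ vs)) ⟩
    length vs ℕ.* α v ℕ.+ a ℕ.+ T vs ℕ.+ (α v ℕ.+ a)
      ≡⟨ solve 4 (λ l x a t → l :* x :+ a :+ t :+ (x :+ a) := l :* x :+ a :+ x :+ (t :+ a)) refl
           (length vs) (α v) a (T vs) ⟩
    length vs ℕ.* α v ℕ.+ a ℕ.+ α v ℕ.+ (T vs ℕ.+ a)
      ≤⟨ ℕ.+-monoʳ-≤ _ (T+∑α≤length*∑α vs) ⟩
    length vs ℕ.* α v ℕ.+ a ℕ.+ α v ℕ.+ length vs ℕ.* a
      ≡⟨ solve 3 (λ l x a → l :* x :+ a :+ x :+ l :* a := (con 1 :+ l) :* (x :+ a)) refl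
           (length vs) (α v) a ⟩
    suc (length vs) ℕ.* (α v ℕ.+ a) ∎
    where
    open ℕ.≤-Reasoning
    open +-*-Solver
    a = ∑ α vs
    ∑h≤ : ∀ ws → ∑ (h v) ws ℕ.≤ length ws ℕ.* α v ℕ.+ ∑ α ws
    ∑h≤ []       = z≤n
    ∑h≤ (w ∷ ws) = begin
      h v w ℕ.+ ∑ (h v) ws
        ≤⟨ ℕ.+-mono-≤ (ℕ.*-monoˡ-≤ (α v ℕ.+ α w) ([]₁≤1 (E? v w))) (∑h≤ ws) ⟩
      1 ℕ.* (α v ℕ.+ α w) ℕ.+ (length ws ℕ.* α v ℕ.+ ∑ α ws)
        ≡⟨ solve 4 (λ x y l a → con 1 :* (x :+ y) :+ (l :* x :+ a) := x :+ l :* x :+ (y :+ a)) refl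
             (α v) (α w) (length ws) (∑ α ws) ⟩
      α v ℕ.+ length ws ℕ.* α v ℕ.+ (α w ℕ.+ ∑ α ws) ∎

  -- Operations on paths, and long paths with both ends in A.

  join : ∀ {x y z w vs ws} → Path E x y vs → E y z → Path E z w ws → Path E x w (vs ++ ws)
  join [ _ ]   e q = e ∷ q
  join (d ∷ p) e q = d ∷ join p e q

  rev : ∀ {x y vs} → Path E x y vs → Path E y x (reverse vs)
  rev [ x ] = [ x ]
  rev (_∷_ {x} {vs = vs} e p) =
    subst (Path E _ _) (sym (List.unfold-reverse x vs)) (join (rev p) (E-sym e) [ x ])

  path-head : ∀ {x y v vs} → Path E x y (v ∷ vs) → Path E v y (v ∷ vs)
  path-head [ x ]   = [ x ]
  path-head (e ∷ p) = e ∷ p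

  path-head-≡ : ∀ {x y v vs} → Path E x y (v ∷ vs) → x ≡ v
  path-head-≡ [ x ]   = refl
  path-head-≡ (e ∷ p) = refl

  cut : ∀ {x y c} a as bs → Path E x y (a ∷ as ++ c ∷ bs) →
        ∃ λ z → Path E x z (a ∷ as) × E z c × Path E c y (c ∷ bs)
  cut a [] bs (_∷_ {x} e p) with path-head-≡ p
  ... | refl = x , [ x ] , e , p
  cut a (a′ ∷ as) bs (e ∷ p) with cut a′ as bs p
  ... | z , q , d , r = z , e ∷ q , d , r

  -- The cycle is opened just before `c`: first the part from `c` on, then the closing edge, then
  -- the initial part.
  rotate : ∀ {x y c} as bs → Path E x y (as ++ c ∷ bs) → E y x →
           ∃ λ z → Path E c z ((c ∷ bs) ++ as)
  rotate []       bs p _ = _ , subst (Path E _ _) (sym (List.++-identityʳ _)) (path-head p)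
  rotate (a ∷ as) bs p e with cut a as bs p
  ... | z , q , _ , r = z , join r e q

  GoodPath : Set
  GoodPath = ∃₂ λ x y → ∃ λ vs → Path E x y vs × A x × A y × Unique vs ×
         (length vs ≡ K ⊎ length vs ≡ suc K)

  prefix : ∀ m {x y vs} → Path E x y vs → suc (suc m) ℕ.≤ length vs →
           ∃₂ λ z w → ∃₂ λ as bs → Path E x z as × E z w × length as ≡ suc m × vs ≡ as ++ w ∷ bs
  prefix m       [ _ ]                 (s≤s ())
  prefix zero    (e ∷ [ y ])           _ = _ , _ , _ , _ , [ _ ] , e , refl , refl
  prefix zero    (e ∷ (d ∷ p))         _ = _ , _ , _ , _ , [ _ ] , e , refl , refl
  prefix (suc m) (_∷_ {x} e p)   (s≤s l) with prefix m p l
  ... | z , w , as , bs , q , d , len , eq = z , w , x ∷ as , bs , e ∷ q , d , cong suc len , cong (x ∷_) eq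

  -- Stop at the 2k-th vertex `z` if it lies in A. Otherwise its successor `w` does, because B spans
  -- no edge, and stopping there gives order 2k + 1.
  long-path-from-A : ∀ {x y vs} → Path E x y vs → Unique vs → A x → suc K ℕ.≤ length vs → GoodPath
  long-path-from-A {x} p u Ax l with prefix _ p l
  ... | z , w , as , bs , q , e , len , refl with A? z
  ...   | yes Az = x , z , as , q , Ax , Az , Unique-++⁻ˡ as u , inj₁ len
  ...   | no ¬Az with indep e
  ...     | inj₁ Az = contradiction Az ¬Az
  ...     | inj₂ Aw = x , w , as ++ w ∷ [] , join q e [ w ] , Ax , Aw
                    , Unique-++⁻ˡ (as ++ w ∷ []) (subst Unique (sym (List.++-assoc as (w ∷ []) bs)) u)
                    , inj₂ (≡.trans (List.length-++ as) (≡.trans (cong (ℕ._+ 1) len) (ℕ.+-comm K 1)))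

  -- If the path starts outside A, its second vertex is in A; the summand `β x` pays for dropping
  -- the first one.
  long-path : ∀ {x y vs} → Path E x y vs → Unique vs → suc K ℕ.+ β x ℕ.≤ length vs → GoodPath
  long-path {x} p u l with A? x
  ... | yes Ax = long-path-from-A p u Ax (ℕ.≤-trans (ℕ.m≤m+n (suc K) 0) l)
  long-path [ _ ] u (s≤s ()) | no ¬Ax
  long-path (e ∷ p) (_ ∷ u) l | no ¬Ax with indep e
  ... | inj₁ Ax = contradiction Ax ¬Ax
  ... | inj₂ Ay = long-path-from-A p u Ay (ℕ.≤-pred (ℕ.≤-trans (ℕ.≤-reflexive (ℕ.+-comm 1 (suc K))) l))

  -- Crossing chords, and growing a path until it closes up to a cycle.

  Crossing : V → V → V → List V → Set
  Crossing x w y vs = ∃₂ λ y′ z → ∃₂ λ as bs →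
    Path E y y′ as × Path E z w bs × vs ≡ as ++ bs × E w y′ × E x z

  -- If no two consecutive vertices y, z of the path have y adjacent to its end w and z adjacent to
  -- x, then each consecutive pair carries at most one of the edges wy, xz.
  crossing : ∀ x {w y vs} → Path E y w vs →
             Crossing x w y vs ⊎ suc (∑ (e w) vs ℕ.+ ∑ (e x) vs) ℕ.≤ length vs ℕ.+ e x y
  crossing x [ w ] rewrite e-irrefl w | ℕ.+-identityʳ (e x w) = inj₂ ℕ.≤-refl
  crossing x {w} {y} (_∷_ {y = z} {vs = vs} d p) with crossing x p
  ... | inj₁ (y′ , z′ , as , bs , q , r , eq , c₁ , c₂) =
    inj₁ (y′ , z′ , y ∷ as , bs , d ∷ q , r , cong (y ∷_) eq , c₁ , c₂)
  ... | inj₂ le with E? w y | E? x z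
  ...   | yes c₁ | yes c₂ = inj₁ (y , z , y ∷ [] , vs , [ y ] , p , refl , c₁ , c₂)
  ...   | yes _  | no  _ = inj₂ (s≤s (begin
    suc (∑ (e w) vs ℕ.+ (e x y ℕ.+ ∑ (e x) vs))
      ≡⟨ solve 3 (λ a b c → con 1 :+ (a :+ (b :+ c)) := con 1 :+ (a :+ c) :+ b) refl
           (∑ (e w) vs) (e x y) (∑ (e x) vs) ⟩
    suc (∑ (e w) vs ℕ.+ ∑ (e x) vs) ℕ.+ e x y
      ≤⟨ ℕ.+-monoˡ-≤ (e x y) le ⟩
    length vs ℕ.+ 0 ℕ.+ e x y
      ≡⟨ cong (ℕ._+ e x y) (ℕ.+-identityʳ (length vs)) ⟩
    length vs ℕ.+ e x y ∎))
    where
    open ℕ.≤-Reasoning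
    open +-*-Solver
  ...   | no  _  | c = inj₂ (begin
    suc (∑ (e w) vs ℕ.+ (e x y ℕ.+ ∑ (e x) vs))
      ≡⟨ solve 3 (λ a b c → con 1 :+ (a :+ (b :+ c)) := con 1 :+ (a :+ c) :+ b) refl
           (∑ (e w) vs) (e x y) (∑ (e x) vs) ⟩
    suc (∑ (e w) vs ℕ.+ ∑ (e x) vs) ℕ.+ e x y
      ≤⟨ ℕ.+-monoˡ-≤ (e x y) le ⟩
    length vs ℕ.+ [ c ]₁ ℕ.+ e x y
      ≤⟨ ℕ.+-monoˡ-≤ (e x y) (ℕ.+-monoʳ-≤ (length vs) ([]₁≤1 c)) ⟩
    length vs ℕ.+ 1 ℕ.+ e x y
      ≡⟨ cong (ℕ._+ e x y) (ℕ.+-comm (length vs) 1) ⟩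
    suc (length vs ℕ.+ e x y) ∎)
    where
    open ℕ.≤-Reasoning
    open +-*-Solver

  -- With crossing chords, follow the path from `x` to `y′`, jump to the end `y`, and walk back to
  -- `z`, which is adjacent to `x`. Without them, the count in `crossing` contradicts the assumed
  -- degree sum, since `e x x` is 0.
  cycle-through : ∀ {x y vs} → Path E x y vs → length vs ℕ.≤ ∑ (e y) vs ℕ.+ ∑ (e x) vs →
                  ∃₂ λ z ws → Path E x z ws × E z x × vs ↭ ws
  cycle-through {x} {y} {vs} p l with crossing x p
  ... | inj₁ (y′ , z , as , bs , q , r , refl , c₁ , c₂) =
    z , as ++ reverse bs , join q (E-sym c₁) (rev r) , E-sym c₂ , ↭.++⁺ˡ as (↭-sym (↭.↭-reverse bs))
  ... | inj₂ le = contradiction l (ℕ.<⇒≱ (ℕ.≤-trans le (ℕ.≤-reflexive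
    (≡.trans (cong (length vs ℕ.+_) (e-irrefl x)) (ℕ.+-identityʳ (length vs))))))

  -- No edge leaves the cycle, so `T` and `W` both split along `vs ++ R`. A single edge traversed
  -- back and forth counts as a cycle on two vertices.
  ClosedCycle : List V → Set
  ClosedCycle S = ∃₂ λ x y → ∃₂ λ vs R →
    Path E x y vs × E y x × S ↭ vs ++ R × ¬ Any (λ c → Any (E c) R) vs

  extend-↭ : ∀ {vs ws : List V} as {r} bs → vs ↭ ws → vs ++ (as ++ r ∷ bs) ↭ (r ∷ ws) ++ (as ++ bs)
  extend-↭ {vs} {ws} as {r} bs p = ↭-trans (↭.++⁺ʳ (as ++ r ∷ bs) p)
    (↭-trans (↭.++⁺ˡ ws (↭.shift r as bs)) (↭.shift r ws (as ++ bs)))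

  module _ {S : List V} (S! : Unique S) (deg : ∀ {v} → v ∈ S → k ℕ.+ β v ℕ.≤ ∑ (e v) S) where

    -- A path that cannot be prolonged at either end closes up to a cycle by the degree condition,
    -- and an edge leaving the cycle yields a longer path; paths of order 2k + 2 are long enough.
    explore : ∀ fuel {x y vs} R → Path E x y vs → S ↭ vs ++ R → suc (suc K) ℕ.≤ fuel ℕ.+ length vs →
              GoodPath ⊎ ClosedCycle S
    explore zero {x} {vs = vs} R p S↭ l = inj₁ (long-path p (Unique-++⁻ˡ vs (Unique-↭ S↭ S!))
      (ℕ.≤-trans (ℕ.+-monoʳ-≤ (suc K) ([]₀≤1 (A? x))) (ℕ.≤-trans (ℕ.≤-reflexive (ℕ.+-comm (suc K) 1)) l)))
    explore (suc fuel) {x} {y} {vs} R p S↭ l = by-head (any? (E? x) R)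
      where
      extend : ∀ {a b ws} → Path E a b ws → vs ↭ ws → Any (E a) R → GoodPath ⊎ ClosedCycle S
      extend {ws = ws} q vs↭ws any with Any-∃++ any
      ... | r , as , bs , e , refl = explore fuel (as ++ bs) (E-sym e ∷ q)
        (↭-trans S↭ (extend-↭ as bs vs↭ws))
        (subst (suc (suc K) ℕ.≤_) (≡.trans (cong (λ i → suc (fuel ℕ.+ i)) (↭.↭-length vs↭ws))
          (sym (ℕ.+-suc fuel (length ws)))) l)

      deg-in-path : ∀ {v} → v ∈ vs → ¬ Any (E v) R → k ℕ.+ β v ℕ.≤ ∑ (e v) vs
      deg-in-path {v} v∈vs ¬any = ℕ.≤-trans (deg (↭.∈-resp-↭ (↭-sym S↭) (∈-++⁺ˡ v∈vs))) (ℕ.≤-reflexive (begin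
        ∑ (e v) S               ≡⟨ ∑-↭ (e v) S↭ ⟩
        ∑ (e v) (vs ++ R)       ≡⟨ ∑-++ (e v) vs R ⟩
        ∑ (e v) vs ℕ.+ ∑ (e v) R ≡⟨ cong (∑ (e v) vs ℕ.+_) (¬Any⇒∑e≡0 v R ¬any) ⟩
        ∑ (e v) vs ℕ.+ 0        ≡⟨ ℕ.+-identityʳ _ ⟩
        ∑ (e v) vs              ∎))
        where open ≡.≡-Reasoning

      by-cycle : ∃₂ (λ z ws → Path E x z ws × E z x × vs ↭ ws) → GoodPath ⊎ ClosedCycle S
      by-cycle (z , ws , q , e , vs↭ws) with any? (λ c → any? (E? c) R) ws
      ... | no ¬any = inj₂ (x , z , ws , R , q , e , ↭-trans S↭ (↭.++⁺ʳ R vs↭ws) , ¬any)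
      ... | yes any with Any-∃++ any
      ...   | c , as , bs , c-any , refl with rotate as bs q e
      ...     | z′ , q′ = extend q′ (↭-trans vs↭ws (↭.++-comm as (c ∷ bs))) c-any

      by-length : ¬ Any (E x) R → ¬ Any (E y) R → GoodPath ⊎ ClosedCycle S
      by-length ¬x ¬y with suc K ℕ.+ β x ℕ.≤? length vs
      ... | yes l′ = inj₁ (long-path p (Unique-++⁻ˡ vs (Unique-↭ S↭ S!)) l′)
      -- Too short for `long-path` means at most `K + β x` vertices, while the ends have degrees at
      -- least `k + β x` and `k + β y` inside the path. The `β` in the degree assumption thus
      -- offsets the one in `long-path`, and Dirac's condition holds.
      ... | no ¬l′ = by-cycle (cycle-through p (begin
        length vs                 ≤⟨ ℕ.≤-pred (ℕ.≰⇒> ¬l′) ⟩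
        K ℕ.+ β x                 ≤⟨ ℕ.m≤m+n (K ℕ.+ β x) (β y) ⟩
        K ℕ.+ β x ℕ.+ β y         ≡⟨ solve 3 (λ k a b → con 2 :* k :+ a :+ b := k :+ b :+ (k :+ a)) refl k (β x) (β y) ⟩
        k ℕ.+ β y ℕ.+ (k ℕ.+ β x) ≤⟨ ℕ.+-mono-≤ (deg-in-path (last∈ p) ¬y) (deg-in-path (head∈ p) ¬x) ⟩
        ∑ (e y) vs ℕ.+ ∑ (e x) vs ∎))
        where
        open ℕ.≤-Reasoning
        open +-*-Solver
        head∈ : ∀ {x y vs} → Path E x y vs → x ∈ vs
        head∈ [ x ]   = here refl
        head∈ (_ ∷ _) = here refl
        last∈ : ∀ {x y vs} → Path E x y vs → y ∈ vs
        last∈ [ x ]   = here refl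
        last∈ (_ ∷ p) = there (last∈ p)

      by-last : ¬ Any (E x) R → Dec (Any (E y) R) → GoodPath ⊎ ClosedCycle S
      by-last ¬x (yes any) = extend (rev p) (↭-sym (↭.↭-reverse vs)) any
      by-last ¬x (no ¬y)   = by-length ¬x ¬y

      by-head : Dec (Any (E x) R) → GoodPath ⊎ ClosedCycle S
      by-head (yes any) = extend p refl any
      by-head (no ¬x)   = by-last ¬x (any? (E? y) R)

  -- The bound on a closed cycle, and the induction over vertex lists.

  AA-edge : V → V → List V → Set
  AA-edge x y vs = ∃₂ λ p q → ∃₂ λ as bs →
    Path E x p as × Path E q y bs × vs ≡ as ++ bs × A p × A q

  -- If no two consecutive vertices are in A, each vertex of A except possibly the last is followed
  -- by one of B, so |A| exceeds |B| by at most `α y`. A start in B is not such a follower, which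
  -- gains the term `β x` and carries the induction.
  AA-edge-or-sparse : ∀ {x y vs} → Path E x y vs →
    AA-edge x y vs ⊎ ∑ α vs ℕ.+ β x ℕ.≤ ∑ β vs ℕ.+ α y
  AA-edge-or-sparse [ x ] with A? x
  ... | yes _ = inj₂ ℕ.≤-refl
  ... | no  _ = inj₂ ℕ.≤-refl
  AA-edge-or-sparse (_∷_ {x} {x′} {y} {vs} d r) with AA-edge-or-sparse r
  ... | inj₁ (p , q , as , bs , r₁ , r₂ , eq , Ap , Aq) =
    inj₁ (p , q , x ∷ as , bs , d ∷ r₁ , r₂ , cong (x ∷_) eq , Ap , Aq)
  ... | inj₂ le with A? x | A? x′
  ...   | yes Ax | yes Ax′ = inj₁ (x , x′ , x ∷ [] , vs , [ x ] , r , refl , Ax , Ax′)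
  ...   | yes _  | no  _   = inj₂ (subst (ℕ._≤ ∑ β vs ℕ.+ α y)
    (≡.trans (ℕ.+-comm (∑ α vs) 1) (sym (ℕ.+-identityʳ _))) le)
  ...   | no  _  | _       = inj₂ (subst (ℕ._≤ suc (∑ β vs ℕ.+ α y)) (ℕ.+-comm 1 (∑ α vs))
    (s≤s (ℕ.≤-trans (ℕ.m≤m+n (∑ α vs) _) le)))

  -- With at most 2k - 1 vertices, every degree is at most 2k - 2, which is already the share of a
  -- vertex of A in `W`.
  T≤W-if-short : ∀ vs → length vs ℕ.< K → T vs ℕ.≤ W vs
  T≤W-if-short vs l = ℕ.≤-trans (ℕ.+-cancelʳ-≤ (∑ α vs) _ _ (begin
    T vs ℕ.+ ∑ α vs             ≤⟨ T+∑α≤length*∑α vs ⟩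
    length vs ℕ.* ∑ α vs        ≤⟨ ℕ.*-monoˡ-≤ (∑ α vs) (ℕ.≤-pred l) ⟩
    -- The first factor is what `K - 1` computes to.
    (j ℕ.+ suc (j ℕ.+ 0)) ℕ.* ∑ α vs
      ≡⟨ solve 2 (λ j a → (j :+ (con 1 :+ (j :+ con 0))) :* a := con 2 :* j :* a :+ a) refl j (∑ α vs) ⟩
    2 ℕ.* j ℕ.* ∑ α vs ℕ.+ ∑ α vs ∎)) (ℕ.m≤m+n _ _)
    where
    open ℕ.≤-Reasoning
    open +-*-Solver

  -- With 2k vertices, a vertex of A may exceed its share 2k - 2 by one. The total excess |A| is at
  -- most |B|, and the vertices of B contribute k|B| to `W`.
  T≤W-if-sparse : ∀ vs → length vs ≡ K → ∑ α vs ℕ.≤ ∑ β vs → T vs ℕ.≤ W vs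
  T≤W-if-sparse vs l a≤b = ℕ.+-cancelʳ-≤ (∑ α vs) _ _ (begin
    T vs ℕ.+ ∑ α vs             ≤⟨ T+∑α≤length*∑α vs ⟩
    length vs ℕ.* ∑ α vs        ≡⟨ cong (ℕ._* ∑ α vs) l ⟩
    K ℕ.* ∑ α vs
      ≡⟨ solve 2 (λ j a → con 2 :* (con 1 :+ j) :* a := con 2 :* j :* a :+ a :+ a) refl j (∑ α vs) ⟩
    2 ℕ.* j ℕ.* ∑ α vs ℕ.+ ∑ α vs ℕ.+ ∑ α vs
      ≤⟨ ℕ.+-monoˡ-≤ (∑ α vs) (ℕ.+-monoʳ-≤ (2 ℕ.* j ℕ.* ∑ α vs)
           (ℕ.≤-trans a≤b (ℕ.m≤m+n (∑ β vs) (j ℕ.* ∑ β vs)))) ⟩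
    W vs ℕ.+ ∑ α vs ∎)
    where
    open ℕ.≤-Reasoning
    open +-*-Solver

  -- On a cycle of order exactly 2k, an edge inside A can be cut to give a path of order 2k with both
  -- ends in A; without such an edge at most half of the vertices are in A.
  cycle-bound : ∀ {x y vs} → Unique vs → Path E x y vs → E y x → GoodPath ⊎ T vs ℕ.≤ W vs
  cycle-bound {x} {y} {vs} u p c with ℕ.<-cmp (length vs) K
  ... | tri< l _ _ = inj₂ (T≤W-if-short vs l)
  ... | tri> _ _ l with indep c
  ...   | inj₂ Ax = inj₁ (long-path-from-A p u Ax l)
  ...   | inj₁ Ay = inj₁ (long-path-from-A (rev p) (Unique-↭ (↭-sym (↭.↭-reverse vs)) u) Ay
                      (subst (suc K ℕ.≤_) (sym (List.length-reverse vs)) l))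
  cycle-bound {x} {y} {vs} u p c | tri≈ _ l _ with AA-edge-or-sparse p
  ... | inj₁ (a , b , as , bs , q , r , refl , Aa , Ab) =
    inj₁ (b , a , bs ++ as , join r c q , Ab , Aa , Unique-↭ (↭.++-comm as bs) u
         , inj₁ (≡.trans (↭.↭-length (↭.++-comm bs as)) l))
  -- The closing edge is not among the consecutive pairs of `p`. If both its ends are in A, then `p`
  -- itself is good; otherwise `β x` and `α y` in `le` leave |A| ≤ |B|.
  ... | inj₂ le with A? x | A? y
  ...   | yes Ax | yes Ay = inj₁ (x , y , vs , p , Ax , Ay , u , inj₁ l)
  ...   | _ | no _  = inj₂ (T≤W-if-sparse vs l (ℕ.≤-trans (ℕ.m≤m+n _ _)
                        (ℕ.≤-trans le (ℕ.≤-reflexive (ℕ.+-identityʳ _)))))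
  ...   | no _ | yes _ = inj₂ (T≤W-if-sparse vs l (ℕ.+-cancelʳ-≤ 1 _ _ le))

  -- An edge at `v` counts at most `1 + α v` times in `T`. So a vertex of A with at most k - 1
  -- neighbours adds at most 2(k - 1), and a vertex of B with at most k neighbours adds at most k:
  -- exactly the share of `v` in `W`.
  T≤W-∷ : ∀ {v} R → ∑ (e v) R ℕ.< k ℕ.+ β v → T R ℕ.≤ W R → T (v ∷ R) ℕ.≤ W (v ∷ R)
  T≤W-∷ {v} R low T≤W = begin
    ∑ (h v) R ℕ.+ T R  ≤⟨ ℕ.+-mono-≤ ∑h≤ T≤W ⟩
    2 ℕ.* j ℕ.* α v ℕ.+ k ℕ.* β v ℕ.+ W R
      ≡⟨ solve 6 (λ x y a b c d → x :* a :+ y :* c :+ (x :* b :+ y :* d) := x :* (a :+ b) :+ y :* (c :+ d)) refl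
         (2 ℕ.* j) k (α v) (∑ α R) (β v) (∑ β R) ⟩
    W (v ∷ R)          ∎
    where
    open ℕ.≤-Reasoning
    open +-*-Solver
    h≤ : ∀ w → h v w ℕ.≤ (1 ℕ.+ α v) ℕ.* e v w
    h≤ w = ℕ.≤-trans (ℕ.*-monoʳ-≤ (e v w) (ℕ.≤-trans (ℕ.+-monoʳ-≤ (α v) ([]₁≤1 (A? w))) (ℕ.≤-reflexive (ℕ.+-comm (α v) 1))))
             (ℕ.≤-reflexive (ℕ.*-comm (e v w) (1 ℕ.+ α v)))
    weight : (1 ℕ.+ α v) ℕ.* ∑ (e v) R ℕ.≤ 2 ℕ.* j ℕ.* α v ℕ.+ k ℕ.* β v
    weight with A? v
    ... | yes _ = begin
      2 ℕ.* ∑ (e v) R            ≤⟨ ℕ.*-monoʳ-≤ 2 (ℕ.≤-pred (ℕ.≤-trans low (ℕ.≤-reflexive (ℕ.+-identityʳ k)))) ⟩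
      2 ℕ.* j                    ≡⟨ solve 1 (λ j → con 2 :* j := con 2 :* j :* con 1 :+ (con 1 :+ j) :* con 0) refl j ⟩
      2 ℕ.* j ℕ.* 1 ℕ.+ k ℕ.* 0  ∎
    ... | no _ = begin
      1 ℕ.* ∑ (e v) R            ≡⟨ ℕ.*-identityˡ _ ⟩
      ∑ (e v) R                  ≤⟨ ℕ.≤-pred (ℕ.≤-trans low (ℕ.≤-reflexive (ℕ.+-comm k 1))) ⟩
      k                          ≡⟨ solve 1 (λ j → con 1 :+ j := con 2 :* j :* con 0 :+ (con 1 :+ j) :* con 1) refl j ⟩
      2 ℕ.* j ℕ.* 0 ℕ.+ k ℕ.* 1  ∎
    ∑h≤ : ∑ (h v) R ℕ.≤ 2 ℕ.* j ℕ.* α v ℕ.+ k ℕ.* β v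
    ∑h≤ = begin
      ∑ (h v) R                              ≤⟨ ∑-mono-≤ h≤ R ⟩
      ∑ (λ w → (1 ℕ.+ α v) ℕ.* e v w) R      ≡⟨ ∑-distribˡ-* (1 ℕ.+ α v) (e v) R ⟩
      (1 ℕ.+ α v) ℕ.* ∑ (e v) R              ≤⟨ weight ⟩
      2 ℕ.* j ℕ.* α v ℕ.+ k ℕ.* β v          ∎

  T≤W-++ : ∀ vs R → ¬ Any (λ c → Any (E c) R) vs → T vs ℕ.≤ W vs → T R ℕ.≤ W R → T (vs ++ R) ℕ.≤ W (vs ++ R)
  T≤W-++ vs R ¬any le₁ le₂ = begin
    T (vs ++ R)                              ≡⟨ T-++ vs R ⟩
    ∑ (λ v → ∑ (h v) R) vs ℕ.+ (T vs ℕ.+ T R) ≡⟨ cong (ℕ._+ (T vs ℕ.+ T R)) (no-edges vs ¬any) ⟩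
    T vs ℕ.+ T R                             ≤⟨ ℕ.+-mono-≤ le₁ le₂ ⟩
    W vs ℕ.+ W R                             ≡⟨ W-++ vs R ⟨
    W (vs ++ R)                              ∎
    where
    open ℕ.≤-Reasoning
    no-edges : ∀ vs → ¬ Any (λ c → Any (E c) R) vs → ∑ (λ v → ∑ (h v) R) vs ≡ 0
    no-edges []       _ = refl
    no-edges (v ∷ vs) ¬any rewrite ¬Any⇒∑h≡0 v R (λ a → ¬any (here a)) =
      no-edges vs (λ a → ¬any (there a))

  -- Induction on a bound `N` for the order rather than on `S`, because a step removes either one
  -- vertex from anywhere in the list or a whole cycle.
  good-path-or-bound : ∀ N S → length S ℕ.≤ N → Unique S → GoodPath ⊎ T S ℕ.≤ W S
  good-path-or-bound N       []        _ _ = inj₂ z≤n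
  good-path-or-bound (suc N) S@(x ∷ R) l S! = by-low-degree (any? (λ v → ∑ (e v) S ℕ.<? k ℕ.+ β v) S)
    where
    transport : ∀ {ws} → S ↭ ws → GoodPath ⊎ T ws ℕ.≤ W ws → GoodPath ⊎ T S ℕ.≤ W S
    transport S↭ (inj₁ g)  = inj₁ g
    transport S↭ (inj₂ le) = inj₂ (≡.subst₂ ℕ._≤_ (sym (T-↭ S↭)) (sym (W-↭ S↭)) le)

    recurse : ∀ {y vs R′} → S ↭ (y ∷ vs) ++ R′ → GoodPath ⊎ T R′ ℕ.≤ W R′
    recurse {y} {vs} {R′} S↭ = good-path-or-bound N R′
      (ℕ.≤-trans (ℕ.m≤n+m (length R′) (length vs))
        (ℕ.≤-trans (ℕ.≤-reflexive (sym (List.length-++ vs)))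
          (ℕ.≤-pred (subst (ℕ._≤ suc N) (↭.↭-length S↭) l))))
      (Unique-++⁻ˡ R′ (Unique-↭ (↭-trans S↭ (↭.++-comm (y ∷ vs) R′)) S!))

    by-low-degree : Dec (Any (λ v → ∑ (e v) S ℕ.< k ℕ.+ β v) S) → GoodPath ⊎ T S ℕ.≤ W S
    by-low-degree (yes any) with Any-∃++ any
    ... | v , as , bs , low , eq = remove (↭-trans (↭-reflexive eq) (↭.shift v as bs))
      where
      remove : S ↭ v ∷ as ++ bs → GoodPath ⊎ T S ℕ.≤ W S
      remove S↭ with recurse {vs = []} {R′ = as ++ bs} S↭
      ... | inj₁ g  = inj₁ g
      ... | inj₂ le = transport S↭ (inj₂ (T≤W-∷ (as ++ bs)
        (ℕ.≤-<-trans (ℕ.≤-trans (ℕ.m≤n+m _ (e v v)) (ℕ.≤-reflexive (sym (∑-↭ (e v) S↭)))) low) le))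
    by-low-degree (no ¬low) with explore S! (λ v∈S → ℕ.≮⇒≥ (λ low → ¬low (lose v∈S low)))
                                   -- No vertex has low degree now. Starting from a single vertex,
                                   -- `suc K` prolongations reach the order 2k + 2 at which
                                   -- `explore` stops.
                                   (suc K) R [ x ] refl (ℕ.≤-reflexive (ℕ.+-comm 1 (suc K)))
    ... | inj₁ g = inj₁ g
    ... | inj₂ (_ , _ , [] , _ , () , _)
    ... | inj₂ (_ , _ , vs@(_ ∷ vs′) , R′ , p , c , S↭ , ¬any)
      with cycle-bound (Unique-++⁻ˡ vs (Unique-↭ S↭ S!)) p c | recurse {vs = vs′} {R′ = R′} S↭
    ...   | inj₁ g   | _        = inj₁ g
    ...   | inj₂ _   | inj₁ g   = inj₁ g
    ...   | inj₂ le₁ | inj₂ le₂ = transport S↭ (inj₂ (T≤W-++ vs R′ ¬any le₁ le₂))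

-- From paths to cycles through a vertex, and the degree sum over its neighbourhood.

module _ {V : Set} {E : Rel V 0ℓ} where

  Path-map : {F : Rel V 0ℓ} → E ⇒ F → ∀ {x y vs} → Path E x y vs → Path F x y vs
  Path-map f [ x ]   = [ x ]
  Path-map f (e ∷ p) = f e ∷ Path-map f p

  lookup-first : ∀ {x y vs} → Path E x y vs → ∀ i → toℕ i ≡ 0 → lookup vs i ≡ x
  lookup-first [ _ ]   zero _ = refl
  lookup-first (_ ∷ _) zero _ = refl

  lookup-last : ∀ {x y vs} → Path E x y vs → ∀ i → suc (toℕ i) ≡ length vs → lookup vs i ≡ y
  lookup-last [ _ ]         zero    _ = refl
  lookup-last (_ ∷ [ _ ])   zero    ()
  lookup-last (_ ∷ (_ ∷ _)) zero    ()
  lookup-last (_ ∷ p)       (suc i) eq = lookup-last p i (ℕ.suc-injective eq)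

  lookup-step : ∀ {x y vs} → Path E x y vs → ∀ i j → toℕ j ≡ suc (toℕ i) →
                E (lookup vs i) (lookup vs j)
  lookup-step [ _ ]   zero    zero    ()
  lookup-step (e ∷ p) zero    (suc j) eq = subst (E _) (sym (lookup-first p j (ℕ.suc-injective eq))) e
  lookup-step (_ ∷ p) (suc i) (suc j) eq = lookup-step p i j (ℕ.suc-injective eq)

lookup-injective : ∀ {V : Set} {vs : List V} → Unique vs → Injective _≡_ _≡_ (lookup vs)
lookup-injective (_ ∷ _)  {zero}  {zero}  _  = refl
lookup-injective (px ∷ _) {zero}  {suc j} eq = contradiction eq (All.lookup px (∈-lookup j))
lookup-injective (px ∷ _) {suc i} {zero}  eq = contradiction (sym eq) (All.lookup px (∈-lookup i))
lookup-injective (_ ∷ u)  {suc i} {suc j} eq = cong suc (lookup-injective u eq)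

∑-indicator≤1 : ∀ {n} (u : Fin n) {vs} → Unique vs → ∑ (λ w → [ w Fin.≟ u ]₁) vs ℕ.≤ 1
∑-indicator≤1 u [] = z≤n
∑-indicator≤1 u (_∷_ {v} {vs} v≢ u!) with v Fin.≟ u
... | no  _    = ∑-indicator≤1 u u!
... | yes refl = ℕ.≤-reflexive (cong suc (absent vs v≢))
  where
  absent : ∀ vs → All (v ≢_) vs → ∑ (λ w → [ w Fin.≟ v ]₁) vs ≡ 0
  absent []       []         = refl
  absent (w ∷ vs) (v≢w ∷ v≢) with w Fin.≟ v
  ... | yes w≡v = contradiction (sym w≡v) v≢w
  ... | no  _   = absent vs v≢

module _ {n : ℕ} (G : Graph n) where
  open Graph G

  adj : Fin n → Fin n → ℕ
  adj v w = [ adj? v w ]₁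

  deg : Fin n → ℕ
  deg v = ∑ (adj v) (allFin n)

  closed-path⇒Contains : ∀ {x y vs} → Unique vs → Path Adj x y vs → Adj y x → Contains G (C (length vs))
  closed-path⇒Contains {vs = vs} vs! p c = lookup vs , lookup-injective vs! , preserves
    where
    next : ∀ {i j} → Next i j → Adj (lookup vs i) (lookup vs j)
    next {i} {j} (inj₁ eq)        = lookup-step p i j eq
    next {i} {j} (inj₂ (eq , eq′)) = subst₂ Adj (sym (lookup-last p i eq)) (sym (lookup-first p j eq′)) c
    preserves : ∀ {i j} → i ≢ j × (Next i j ⊎ Next j i) → Adj (lookup vs i) (lookup vs j)
    preserves (_ , inj₁ ij) = next ij
    preserves (_ , inj₂ ji) = adj-sym (next ji)

  module _ (u : Fin n) where

    -- Making u isolated instead of removing it keeps the vertex set Fin n; u then counts as a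
    -- vertex of B, which costs an extra k absorbed by the slack in the theorem.
    E : Rel (Fin n) 0ℓ
    E v w = Adj v w × v ≢ u × w ≢ u × (Adj u v ⊎ Adj u w)

    E? : ∀ v w → Dec (E v w)
    E? v w = adj? v w ×-dec ¬? (v Fin.≟ u) ×-dec ¬? (w Fin.≟ u) ×-dec (adj? u v ⊎-dec adj? u w)

    E-sym : ∀ {v w} → E v w → E w v
    E-sym (vw , v≢u , w≢u , s) = adj-sym vw , w≢u , v≢u , Sum.swap s

    module N (j : ℕ) = PathLemma E E? E-sym (λ (vv , _) → adj-irrefl refl vv) (Adj u) (adj? u)
      (λ (_ , _ , _ , s) → s) j

    -- Edges of `E` miss `u`, which covers every vertex with a successor; the last vertex differs
    -- from `u` because it is adjacent to it.
    avoids : ∀ {x y vs} → Adj u y → Path E x y vs → All (u ≢_) vs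
    avoids uy [ y ]                   = (λ u≡y → adj-irrefl u≡y uy) ∷ []
    avoids uy ((_ , x≢u , _) ∷ p) = ≡.≢-sym x≢u ∷ avoids uy p

    cycles : ∀ j → N.GoodPath j → Contains G (C (2 ℕ.* suc j ℕ.+ 1)) ⊎ Contains G (C (2 ℕ.* suc j ℕ.+ 2))
    cycles j (x , y , vs , p , ux , uy , vs! , len) = by-length len
      where
      cycle : Contains G (C (suc (length vs)))
      cycle = closed-path⇒Contains (avoids uy p ∷ vs!) (ux ∷ Path-map proj₁ p) (adj-sym uy)
      by-length : length vs ≡ 2 ℕ.* suc j ⊎ length vs ≡ suc (2 ℕ.* suc j) → _
      by-length (inj₁ eq) = inj₁ (subst (λ r → Contains G (C r))
        (≡.trans (cong suc eq) (ℕ.+-comm 1 (2 ℕ.* suc j))) cycle)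
      by-length (inj₂ eq) = inj₂ (subst (λ r → Contains G (C r))
        (≡.trans (cong suc eq) (ℕ.+-comm 2 (2 ℕ.* suc j))) cycle)

    -- Every edge at a neighbour of `u` survives in `E`, except the one to `u`.
    deg≤ : ∀ v → Adj u v → deg v ℕ.≤ ∑ (λ w → [ E? v w ]₁) (allFin n) ℕ.+ 1
    deg≤ v uv = begin
      deg v
        ≤⟨ ∑-mono-≤ adj≤ (allFin n) ⟩
      ∑ (λ w → [ E? v w ]₁ ℕ.+ [ w Fin.≟ u ]₁) (allFin n)
        ≡⟨ ∑-distrib-+ _ _ (allFin n) ⟩
      ∑ (λ w → [ E? v w ]₁) (allFin n) ℕ.+ ∑ (λ w → [ w Fin.≟ u ]₁) (allFin n)
        ≤⟨ ℕ.+-monoʳ-≤ _ (∑-indicator≤1 u (Unique.allFin⁺ n)) ⟩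
      ∑ (λ w → [ E? v w ]₁) (allFin n) ℕ.+ 1 ∎
      where
      open ℕ.≤-Reasoning
      adj≤ : ∀ w → adj v w ℕ.≤ [ E? v w ]₁ ℕ.+ [ w Fin.≟ u ]₁
      adj≤ w = []₁-⊎ (adj? v w) (E? v w) (w Fin.≟ u) λ vw → edge vw (w Fin.≟ u)
        where
        edge : Adj v w → Dec (w ≡ u) → E v w ⊎ w ≡ u
        edge vw (yes w≡u) = inj₂ w≡u
        edge vw (no w≢u)  = inj₁ (vw , (λ v≡u → adj-irrefl (sym v≡u) uv) , w≢u , inj₁ uv)

    -- Restoring `u` adds at most 1 for each of its neighbours. With d = `deg u` and b = `∑ β V`,
    -- the bound (2k - 2)d + kb + d equals (k - 1)d + k(d + b), and d + b = n.
    cycle-or-degree-sum : ∀ j →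
      (Contains G (C (2 ℕ.* suc j ℕ.+ 1)) ⊎ Contains G (C (2 ℕ.* suc j ℕ.+ 2))) ⊎
      ∑ (λ v → adj u v ℕ.* deg v) (allFin n) ℕ.≤ j ℕ.* deg u ℕ.+ suc j ℕ.* n
    cycle-or-degree-sum j with N.good-path-or-bound j n (allFin n)
                                 (ℕ.≤-reflexive (List.length-tabulate {n = n} (λ i → i))) (Unique.allFin⁺ n)
    ... | inj₁ good = inj₁ (cycles j good)
    ... | inj₂ T≤W  = inj₂ (begin
      ∑ (λ v → adj u v ℕ.* deg v) V
        ≤⟨ ∑-mono-≤ (λ v → []₁-* (adj? u v) (deg≤ v)) V ⟩
      ∑ (λ v → adj u v ℕ.* ∑ (e v) V ℕ.+ adj u v) V
        ≡⟨ ∑-distrib-+ _ _ V ⟩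
      ∑ (λ v → adj u v ℕ.* ∑ (e v) V) V ℕ.+ deg u
        ≡⟨ cong (ℕ._+ deg u) (T≡∑α*∑e V) ⟨
      T V ℕ.+ deg u
        ≤⟨ ℕ.+-monoˡ-≤ (deg u) T≤W ⟩
      2 ℕ.* j ℕ.* deg u ℕ.+ suc j ℕ.* ∑ β V ℕ.+ deg u
        ≡⟨ solve 3 (λ j d b → con 2 :* j :* d :+ (con 1 :+ j) :* b :+ d := j :* d :+ (con 1 :+ j) :* (d :+ b)) refl
             j (deg u) (∑ β V) ⟩
      j ℕ.* deg u ℕ.+ suc j ℕ.* (deg u ℕ.+ ∑ β V)
        ≡⟨ cong (λ i → j ℕ.* deg u ℕ.+ suc j ℕ.* i)
             (≡.trans (∑α+∑β≡length V) (List.length-tabulate {n = n} (λ i → i))) ⟩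
      j ℕ.* deg u ℕ.+ suc j ℕ.* n ∎)
      where
      open N j
      open ℕ.≤-Reasoning
      open +-*-Solver
      V = allFin n

-- Rational arithmetic and finite sums of rationals.

module Σℚ = SemiringSum (CommutativeRing.semiring ℚ.+-*-commutativeRing)
open Σℚ using () renaming (sum to Σ)

ι : ℕ → ℚ
ι m = + m / 1

toℚᵘ-/ : ∀ m d → toℚᵘ (+ m / suc d) ℚᵘ.≃ mkℚᵘ (+ m) d
toℚᵘ-/ m d = ℚ.toℚᵘ-fromℚᵘ (mkℚᵘ (+ m) d)

ι-+ : ∀ m n → ι (m ℕ.+ n) ≡ ι m ℚ.+ ι n
ι-+ m n = ℚ.toℚᵘ-injective (ℚᵘ.≃-trans (toℚᵘ-/ (m ℕ.+ n) 0) (ℚᵘ.≃-sym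
  (ℚᵘ.≃-trans (ℚ.toℚᵘ-homo-+ (ι m) (ι n)) (ℚᵘ.≃-trans (ℚᵘ.+-cong (toℚᵘ-/ m 0) (toℚᵘ-/ n 0))
    (ℚᵘ.*≡* (cong (ℤ._* + 1) (cong₂ ℤ._+_ (ℤ.*-identityʳ (+ m)) (ℤ.*-identityʳ (+ n)))))))))

ι-* : ∀ m n → ι (m ℕ.* n) ≡ ι m ℚ.* ι n
ι-* m n = ℚ.toℚᵘ-injective (ℚᵘ.≃-trans (toℚᵘ-/ (m ℕ.* n) 0) (ℚᵘ.≃-sym
  (ℚᵘ.≃-trans (ℚ.toℚᵘ-homo-* (ι m) (ι n)) (ℚᵘ.≃-trans (ℚᵘ.*-cong (toℚᵘ-/ m 0) (toℚᵘ-/ n 0))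
    (ℚᵘ.*≡* (cong (ℤ._* + 1) (sym (ℤ.pos-* m n))))))))

ι-*-/ : ∀ m d → ι (suc d) ℚ.* (+ m / suc d) ≡ ι m
ι-*-/ m d = ℚ.toℚᵘ-injective (ℚᵘ.≃-trans (ℚ.toℚᵘ-homo-* (ι (suc d)) (+ m / suc d))
  (ℚᵘ.≃-trans (ℚᵘ.*-cong (toℚᵘ-/ (suc d) 0) (toℚᵘ-/ m d))
    (ℚᵘ.≃-trans (ℚᵘ.*≡* eq) (ℚᵘ.≃-sym (toℚᵘ-/ m 0)))))
  where
  eq : + suc d ℤ.* + m ℤ.* + 1 ≡ + m ℤ.* + (1 ℕ.* suc d)
  eq = ≡.trans (ℤ.*-identityʳ _) (≡.trans (ℤ.*-comm (+ suc d) (+ m))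
    (cong (λ i → + m ℤ.* + i) (sym (ℕ.*-identityˡ (suc d)))))

ι-mono-≤ : ∀ {m n} → m ℕ.≤ n → ι m ℚ.≤ ι n
ι-mono-≤ {m} {n} m≤n = ℚ.toℚᵘ-cancel-≤ (ℚᵘ.≤-respʳ-≃ (ℚᵘ.≃-sym (toℚᵘ-/ n 0))
  (ℚᵘ.≤-respˡ-≃ (ℚᵘ.≃-sym (toℚᵘ-/ m 0)) (ℚᵘ.*≤* (ℤ.*-monoʳ-≤-nonNeg (+ 1) (ℤ.+≤+ m≤n)))))

0≤ι : ∀ m → 0ℚ ℚ.≤ ι m
0≤ι m = ι-mono-≤ {0} {m} z≤n

ι-∑ : ∀ {n} (f : Fin n → ℕ) → ι (∑ f (allFin n)) ≡ Σ (λ i → ι (f i))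
ι-∑ f = ≡.trans (cong (λ l → ι (sum l)) (List.map-tabulate (λ i → i) f)) (go f)
  where
  go : ∀ {n} (f : Fin n → ℕ) → ι (sum (tabulate f)) ≡ Σ (λ i → ι (f i))
  go {zero}  f = refl
  go {suc n} f = ≡.trans (ι-+ (f zero) _) (cong (ι (f zero) ℚ.+_) (go (λ i → f (suc i))))

+-cancelˡ-≤ : ∀ p {q r} → p ℚ.+ q ℚ.≤ p ℚ.+ r → q ℚ.≤ r
+-cancelˡ-≤ p {q} {r} le = subst₂ ℚ._≤_ (eq p q) (eq p r) (ℚ.+-monoʳ-≤ (ℚ.- p) le)
  where
  eq : ∀ p q → ℚ.- p ℚ.+ (p ℚ.+ q) ≡ q
  eq = solve 2 (λ p q → :- p :+ (p :+ q) := q) refl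
    where open ℚ.+-*-Solver

+-cancelˡ-< : ∀ p {q r} → p ℚ.+ q ℚ.< p ℚ.+ r → q ℚ.< r
+-cancelˡ-< p {q} {r} lt = ℚ.≰⇒> λ r≤q → ℚ.<-irrefl refl (ℚ.<-≤-trans lt (ℚ.+-monoʳ-≤ p r≤q))

*-monoˡ-≤ : ∀ {p q r} → 0ℚ ℚ.≤ p → q ℚ.≤ r → p ℚ.* q ℚ.≤ p ℚ.* r
*-monoˡ-≤ {p} 0≤p = ℚ.*-monoˡ-≤-nonNeg p {{nonNegative 0≤p}}

*-monoʳ-≤ : ∀ {p q r} → 0ℚ ℚ.≤ p → q ℚ.≤ r → q ℚ.* p ℚ.≤ r ℚ.* p
*-monoʳ-≤ {p} 0≤p = ℚ.*-monoʳ-≤-nonNeg p {{nonNegative 0≤p}}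

0≤p*q : ∀ {p q} → 0ℚ ℚ.≤ p → 0ℚ ℚ.≤ q → 0ℚ ℚ.≤ p ℚ.* q
0≤p*q {p} {q} 0≤p 0≤q = subst (ℚ._≤ p ℚ.* q) (ℚ.*-zeroʳ p) (*-monoˡ-≤ 0≤p 0≤q)

0<p*q : ∀ {p q} → 0ℚ ℚ.< p → 0ℚ ℚ.< q → 0ℚ ℚ.< p ℚ.* q
0<p*q {p} {q} 0<p 0<q = ℚ.positive⁻¹ (p ℚ.* q) {{ℚ.pos*pos⇒pos p {{positive 0<p}} q {{positive 0<q}}}}

p≤∣p∣ : ∀ p → p ℚ.≤ ∣ p ∣
p≤∣p∣ p with ℚ.≤-total 0ℚ p
... | inj₁ 0≤p = ℚ.≤-reflexive (sym (ℚ.0≤p⇒∣p∣≡p 0≤p))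
... | inj₂ p≤0 = ℚ.≤-trans p≤0 (ℚ.0≤∣p∣ p)

divide : ∀ {p q} → 0ℚ ℚ.< p → 0ℚ ℚ.< q → ∃ λ r → 0ℚ ℚ.< r × r ℚ.* q ≡ p
divide {p} {q} 0<p 0<q = p ℚ.* 1/ q , 0<p*q 0<p (ℚ.positive⁻¹ (1/ q) {{ℚ.1/pos⇒pos q}})
  , ≡.trans (ℚ.*-assoc p (1/ q) q) (≡.trans (cong (p ℚ.*_) (ℚ.*-inverseˡ q)) (ℚ.*-identityʳ p))
  where
  instance
    q⁺ = positive 0<q
    q≢0 = ℚ.pos⇒nonZero q

Σ-mono-≤ : ∀ {n} {f g : Fin n → ℚ} → (∀ i → f i ℚ.≤ g i) → Σ f ℚ.≤ Σ g
Σ-mono-≤ {zero}  f≤g = ℚ.≤-refl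
Σ-mono-≤ {suc n} f≤g = ℚ.+-mono-≤ (f≤g zero) (Σ-mono-≤ (λ i → f≤g (suc i)))

0≤Σ : ∀ {n} {f : Fin n → ℚ} → (∀ i → 0ℚ ℚ.≤ f i) → 0ℚ ℚ.≤ Σ f
0≤Σ {zero}  0≤f = ℚ.≤-refl
0≤Σ {suc n} 0≤f = ℚ.+-mono-≤ (0≤f zero) (0≤Σ (λ i → 0≤f (suc i)))

term≤Σ : ∀ {n} {f : Fin n → ℚ} → (∀ i → 0ℚ ℚ.≤ f i) → ∀ i → f i ℚ.≤ Σ f
term≤Σ {f = f} 0≤f zero    = subst (ℚ._≤ Σ f) (ℚ.+-identityʳ (f zero)) (ℚ.+-monoʳ-≤ (f zero) (0≤Σ (λ i → 0≤f (suc i))))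
term≤Σ {f = f} 0≤f (suc i) = ℚ.≤-trans (term≤Σ (λ i → 0≤f (suc i)) i)
  (subst (ℚ._≤ Σ f) (ℚ.+-identityˡ _) (ℚ.+-monoˡ-≤ _ (0≤f zero)))

∣Σ∣≤Σ∣∣ : ∀ {n} (f : Fin n → ℚ) → ∣ Σ f ∣ ℚ.≤ Σ (λ i → ∣ f i ∣)
∣Σ∣≤Σ∣∣ {zero}  f = ℚ.≤-refl
∣Σ∣≤Σ∣∣ {suc n} f = ℚ.≤-trans (ℚ.∣p+q∣≤∣p∣+∣q∣ (f zero) _) (ℚ.+-monoʳ-≤ ∣ f zero ∣ (∣Σ∣≤Σ∣∣ (λ i → f (suc i))))

eventually-all : ∀ {n} {P : Fin n → ℕ → Set} → (∀ i → ∃ λ N → ∀ m → N ℕ.≤ m → P i m) →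
                 ∃ λ N → ∀ i m → N ℕ.≤ m → P i m
eventually-all {zero}  h = 0 , λ ()
eventually-all {suc n} h with h zero | eventually-all (λ i → h (suc i))
... | M , hM | N , hN = M ℕ.⊔ N , λ where
  zero    m le → hM m (ℕ.m⊔n≤o⇒m≤o M N le)
  (suc i) m le → hN i m (ℕ.m⊔n≤o⇒n≤o M N le)

-- Real operations act termwise on the sequences. When the matrix entries are rational at index `m`,
-- the eigenvalue equation can therefore be studied over ℚ, one index at a time.
seq-*ᵥ : ∀ {n} (A : Matrix n) (b : Fin n → Fin n → ℚ) x i m → (∀ j → seq (A i j) m ≡ b i j) →
         seq ((A *ᵥ x) i) m ≡ Σ (λ j → b i j ℚ.* seq (x j) m)
seq-*ᵥ A b x i m eq = dot (A i) (b i) x eq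
  where
  dot : ∀ {n} (f : Fin n → ℝ) (g : Fin n → ℚ) (x : Fin n → ℝ) → (∀ j → seq (f j) m ≡ g j) →
        seq (foldr _+_ 0ℝ (λ j → f j * x j)) m ≡ Σ (λ j → g j ℚ.* seq (x j) m)
  dot {zero}  f g x eq = refl
  dot {suc n} f g x eq = cong₂ (λ p q → p ℚ.* seq (x zero) m ℚ.+ q) (eq zero)
    (dot (λ j → f (suc j)) (λ j → g (suc j)) (λ j → x (suc j)) (λ j → eq (suc j)))

-- Pairing an approximate eigenvector with a superharmonic vector.

module _ {n} {a : Fin n → Fin n → ℚ} {v : Fin n → ℚ} {ρ : ℚ}
  (0≤a : ∀ i j → 0ℚ ℚ.≤ a i j) (a-sym : ∀ i j → a i j ≡ a j i) (0≤v : ∀ i → 0ℚ ℚ.≤ v i)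
  (a*v≤ρ*v : ∀ i → Σ (λ j → a i j ℚ.* v j) ℚ.≤ ρ ℚ.* v i) where

  -- The triangle inequality gives m|x| ≤ a|x| + η in each entry. Weighting by `v` and summing,
  -- symmetry moves `a` from |x| onto `v`, where it costs at most the factor `ρ`. The error `η` is
  -- present because equality of reals gives only approximate equality at each index.
  weighted-norm-bound : (x : Fin n → ℚ) → ∀ {m δ η} → ρ ℚ.+ δ ℚ.≤ m →
    (∀ i → ∣ Σ (λ j → a i j ℚ.* x j) ℚ.- m ℚ.* x i ∣ ℚ.≤ η) →
    δ ℚ.* Σ (λ i → v i ℚ.* ∣ x i ∣) ℚ.≤ Σ v ℚ.* η
  weighted-norm-bound x {m} {δ} {η} ρ+δ≤m near = +-cancelˡ-≤ (ρ ℚ.* S) (begin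
    ρ ℚ.* S ℚ.+ δ ℚ.* S
      ≡⟨ ℚ.*-distribʳ-+ S ρ δ ⟨
    (ρ ℚ.+ δ) ℚ.* S
      ≤⟨ *-monoʳ-≤ (0≤Σ (λ i → 0≤p*q (0≤v i) (ℚ.0≤∣p∣ (x i)))) ρ+δ≤m ⟩
    m ℚ.* S
      ≡⟨ Σℚ.*-distribˡ-sum m (λ i → v i ℚ.* y i) ⟩
    Σ (λ i → m ℚ.* (v i ℚ.* y i))
      ≤⟨ Σ-mono-≤ weighted-row ⟩
    Σ (λ i → Σ (λ j → v i ℚ.* (a i j ℚ.* y j)) ℚ.+ v i ℚ.* η)
      ≡⟨ Σℚ.∑-distrib-+ (λ i → Σ (λ j → v i ℚ.* (a i j ℚ.* y j))) (λ i → v i ℚ.* η) ⟩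
    Σ (λ i → Σ (λ j → v i ℚ.* (a i j ℚ.* y j))) ℚ.+ Σ (λ i → v i ℚ.* η)
      ≡⟨ cong₂ ℚ._+_ (Σℚ.∑-comm (λ i j → v i ℚ.* (a i j ℚ.* y j))) (sym (Σℚ.*-distribʳ-sum η v)) ⟩
    Σ (λ j → Σ (λ i → v i ℚ.* (a i j ℚ.* y j))) ℚ.+ Σ v ℚ.* η
      ≤⟨ ℚ.+-monoˡ-≤ (Σ v ℚ.* η) (Σ-mono-≤ column) ⟩
    Σ (λ j → ρ ℚ.* (v j ℚ.* y j)) ℚ.+ Σ v ℚ.* η
      ≡⟨ cong (ℚ._+ Σ v ℚ.* η) (Σℚ.*-distribˡ-sum ρ (λ i → v i ℚ.* y i)) ⟨
    ρ ℚ.* S ℚ.+ Σ v ℚ.* η ∎)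
    where
    open ℚ.≤-Reasoning
    open ℚ.+-*-Solver
    y : Fin n → ℚ
    y i = ∣ x i ∣
    S = Σ (λ i → v i ℚ.* y i)
    row : ∀ i → m ℚ.* y i ℚ.≤ Σ (λ j → a i j ℚ.* y j) ℚ.+ η
    row i = begin
      m ℚ.* y i                   ≤⟨ *-monoʳ-≤ (ℚ.0≤∣p∣ (x i)) (p≤∣p∣ m) ⟩
      ∣ m ∣ ℚ.* y i               ≡⟨ ℚ.∣p*q∣≡∣p∣*∣q∣ m (x i) ⟨
      ∣ m ℚ.* x i ∣               ≡⟨ cong ∣_∣ (solve 2 (λ s t → t := s :- (s :- t)) refl s (m ℚ.* x i)) ⟩
      ∣ s ℚ.- (s ℚ.- m ℚ.* x i) ∣ ≤⟨ ℚ.∣p-q∣≤∣p∣+∣q∣ s (s ℚ.- m ℚ.* x i) ⟩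
      ∣ s ∣ ℚ.+ ∣ s ℚ.- m ℚ.* x i ∣ ≤⟨ ℚ.+-mono-≤ (∣Σ∣≤Σ∣∣ (λ j → a i j ℚ.* x j)) (near i) ⟩
      Σ (λ j → ∣ a i j ℚ.* x j ∣) ℚ.+ η
        ≡⟨ cong (ℚ._+ η) (Σℚ.sum-cong-≗ (λ j → ≡.trans (ℚ.∣p*q∣≡∣p∣*∣q∣ (a i j) (x j))
             (cong (ℚ._* y j) (ℚ.0≤p⇒∣p∣≡p (0≤a i j))))) ⟩
      Σ (λ j → a i j ℚ.* y j) ℚ.+ η ∎
      where s = Σ (λ j → a i j ℚ.* x j)
    weighted-row : ∀ i → m ℚ.* (v i ℚ.* y i) ℚ.≤ Σ (λ j → v i ℚ.* (a i j ℚ.* y j)) ℚ.+ v i ℚ.* η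
    weighted-row i = begin
      m ℚ.* (v i ℚ.* y i)         ≡⟨ solve 3 (λ m v y → m :* (v :* y) := v :* (m :* y)) refl m (v i) (y i) ⟩
      v i ℚ.* (m ℚ.* y i)         ≤⟨ *-monoˡ-≤ (0≤v i) (row i) ⟩
      v i ℚ.* (Σ (λ j → a i j ℚ.* y j) ℚ.+ η)
        ≡⟨ ℚ.*-distribˡ-+ (v i) _ η ⟩
      v i ℚ.* Σ (λ j → a i j ℚ.* y j) ℚ.+ v i ℚ.* η
        ≡⟨ cong (ℚ._+ v i ℚ.* η) (Σℚ.*-distribˡ-sum (v i) (λ j → a i j ℚ.* y j)) ⟩
      Σ (λ j → v i ℚ.* (a i j ℚ.* y j)) ℚ.+ v i ℚ.* η ∎
    column : ∀ j → Σ (λ i → v i ℚ.* (a i j ℚ.* y j)) ℚ.≤ ρ ℚ.* (v j ℚ.* y j)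
    column j = begin
      Σ (λ i → v i ℚ.* (a i j ℚ.* y j))
        ≡⟨ Σℚ.sum-cong-≗ (λ i → ≡.trans (cong (λ c → v i ℚ.* (c ℚ.* y j)) (a-sym i j))
             (solve 3 (λ v a y → v :* (a :* y) := a :* v :* y) refl (v i) (a j i) (y j))) ⟩
      Σ (λ i → a j i ℚ.* v i ℚ.* y j)
        ≡⟨ Σℚ.*-distribʳ-sum (y j) (λ i → a j i ℚ.* v i) ⟨
      Σ (λ i → a j i ℚ.* v i) ℚ.* y j
        ≤⟨ *-monoʳ-≤ (ℚ.0≤∣p∣ (x j)) (a*v≤ρ*v j) ⟩
      ρ ℚ.* v j ℚ.* y j
        ≡⟨ ℚ.*-assoc ρ (v j) (y j) ⟩
      ρ ℚ.* (v j ℚ.* y j) ∎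

  eigenvector-vanishes : ∀ {t δ M} (A : Matrix n) μ x → (∀ i j m → seq (A i j) m ≡ a i j) →
    0ℚ ℚ.< t → (∀ i → t ℚ.≤ v i) → 0ℚ ℚ.< δ → (∀ m → M ℕ.≤ m → ρ ℚ.+ δ ℚ.≤ seq μ m) →
    A *ᵥ x ≈ᵥ μ ·ᵥ x → x ≈ᵥ 0ᵥ
  eigenvector-vanishes {t} {δ} {M} A μ x A≡a 0<t t≤v 0<δ ≤μ eigen i ε 0<ε =
    -- Since `v i` is at least `t`, δt|x i| is at most `Σ v * η`. The choice η(1 + Σ v) = δtε brings
    -- this below δtε; the summand 1 makes the divisor positive and the final inequality strict.
    from-η (divide (0<p*q (0<p*q 0<δ 0<t) 0<ε) 0<1+Σv)
    where
    Goal : Set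
    Goal = ∃ λ N → ∀ m → N ℕ.≤ m → ∣ seq (x i) m ℚ.- 0ℚ ∣ ℚ.< ε
    0<1+Σv : 0ℚ ℚ.< 1ℚ ℚ.+ Σ v
    0<1+Σv = ℚ.+-mono-<-≤ (ℚ.positive⁻¹ 1ℚ) (0≤Σ 0≤v)
    from-η : (∃ λ η → 0ℚ ℚ.< η × η ℚ.* (1ℚ ℚ.+ Σ v) ≡ δ ℚ.* t ℚ.* ε) → Goal
    from-η (η , 0<η , η*[1+Σv]≡) = from-N (eventually-all {P = Near} (λ u → eigen u η 0<η))
      where
      Near : Fin n → ℕ → Set
      Near u m = ∣ seq ((A *ᵥ x) u) m ℚ.- seq ((μ ·ᵥ x) u) m ∣ ℚ.< η
      from-N : (∃ λ N → ∀ u m → N ℕ.≤ m → Near u m) → Goal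
      from-N (N , near) = N ℕ.⊔ M , λ m le → bound m (ℕ.m⊔n≤o⇒m≤o N M le) (ℕ.m⊔n≤o⇒n≤o N M le)
        where
        bound : ∀ m → N ℕ.≤ m → M ℕ.≤ m → ∣ seq (x i) m ℚ.- 0ℚ ∣ ℚ.< ε
        bound m N≤m M≤m = subst (ℚ._< ε) (cong ∣_∣ (sym (ℚ.+-identityʳ (seq (x i) m))))
          (ℚ.*-cancelˡ-<-nonNeg (δ ℚ.* t) {{nonNegative (ℚ.<⇒≤ (0<p*q 0<δ 0<t))}} (begin-strict
            δ ℚ.* t ℚ.* ∣ seq (x i) m ∣
              ≡⟨ ℚ.*-assoc δ t _ ⟩
            δ ℚ.* (t ℚ.* ∣ seq (x i) m ∣)
              ≤⟨ *-monoˡ-≤ (ℚ.<⇒≤ 0<δ) (ℚ.≤-trans (*-monoʳ-≤ (ℚ.0≤∣p∣ (seq (x i) m)) (t≤v i))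
                   (term≤Σ (λ u → 0≤p*q (0≤v u) (ℚ.0≤∣p∣ (seq (x u) m))) i)) ⟩
            δ ℚ.* Σ (λ u → v u ℚ.* ∣ seq (x u) m ∣)
              ≤⟨ weighted-norm-bound (λ u → seq (x u) m) (≤μ m M≤m) residual ⟩
            Σ v ℚ.* η
              ≡⟨ ℚ.+-identityˡ (Σ v ℚ.* η) ⟨
            0ℚ ℚ.+ Σ v ℚ.* η
              <⟨ ℚ.+-monoˡ-< (Σ v ℚ.* η) 0<η ⟩
            η ℚ.+ Σ v ℚ.* η
              ≡⟨ cong₂ ℚ._+_ (ℚ.*-identityʳ η) (ℚ.*-comm η (Σ v)) ⟨
            η ℚ.* 1ℚ ℚ.+ η ℚ.* Σ v
              ≡⟨ ℚ.*-distribˡ-+ η 1ℚ (Σ v) ⟨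
            η ℚ.* (1ℚ ℚ.+ Σ v)
              ≡⟨ η*[1+Σv]≡ ⟩
            δ ℚ.* t ℚ.* ε ∎))
          where
          open ℚ.≤-Reasoning
          residual : ∀ u → ∣ Σ (λ w → a u w ℚ.* seq (x w) m) ℚ.- seq μ m ℚ.* seq (x u) m ∣ ℚ.≤ η
          residual u = subst (λ s → ∣ s ℚ.- seq μ m ℚ.* seq (x u) m ∣ ℚ.≤ η)
            (seq-*ᵥ A a x u m (λ w → A≡a u w m)) (ℚ.<⇒≤ (near u m N≤m))

-- The adjacency matrix, the vector of degrees plus `t`, and the choice of `t`.

seq-adjacencyMatrix : ∀ {n} (G : Graph n) i j m → seq (adjacencyMatrix G i j) m ≡ ι (adj G i j)
seq-adjacencyMatrix G i j m = by-cases (does (Graph.adj? G i j))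
  where
  by-cases : ∀ b → seq (if b then 1ℝ else 0ℝ) m ≡ ι (if b then 1 else 0)
  by-cases true  = refl
  by-cases false = refl

adj-symmetric : ∀ {n} (G : Graph n) v w → adj G v w ≡ adj G w v
adj-symmetric G v w with Graph.adj? G v w | Graph.adj? G w v
... | yes _ | yes _ = refl
... | yes p | no ¬p = contradiction (Graph.adj-sym G p) ¬p
... | no ¬p | yes p = contradiction (Graph.adj-sym G p) ¬p
... | no _  | no _  = refl

module _ {n : ℕ} (G : Graph n) (t : ℚ) where

  weight : Fin n → ℚ
  weight v = ι (deg G v) ℚ.+ t

  t≤weight : ∀ v → t ℚ.≤ weight v
  t≤weight v = subst (ℚ._≤ weight v) (ℚ.+-identityˡ t) (ℚ.+-monoˡ-≤ t (0≤ι (deg G v)))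

  -- With d = `deg G u`, the left side is at most jd + c + dt by the degree sums. Replacing c by (j
  -- + t)t turns this into the product (j + t)(d + t).
  weight-superharmonic : ∀ j c →
    (∀ u → ∑ (λ v → adj G u v ℕ.* deg G v) (allFin n) ℕ.≤ j ℕ.* deg G u ℕ.+ c) →
    ι c ℚ.≤ (ι j ℚ.+ t) ℚ.* t →
    ∀ u → Σ (λ v → ι (adj G u v) ℚ.* weight v) ℚ.≤ (ι j ℚ.+ t) ℚ.* weight u
  weight-superharmonic j c degree-sum c≤ u = begin
    Σ (λ v → ι (adj G u v) ℚ.* weight v)
      ≡⟨ Σℚ.sum-cong-≗ (λ v → ≡.trans (ℚ.*-distribˡ-+ (ι (adj G u v)) (ι (deg G v)) t)
           (cong (ℚ._+ ι (adj G u v) ℚ.* t) (sym (ι-* (adj G u v) (deg G v))))) ⟩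
    Σ (λ v → ι (adj G u v ℕ.* deg G v) ℚ.+ ι (adj G u v) ℚ.* t)
      ≡⟨ Σℚ.∑-distrib-+ (λ v → ι (adj G u v ℕ.* deg G v)) (λ v → ι (adj G u v) ℚ.* t) ⟩
    Σ (λ v → ι (adj G u v ℕ.* deg G v)) ℚ.+ Σ (λ v → ι (adj G u v) ℚ.* t)
      ≡⟨ cong₂ ℚ._+_ (sym (ι-∑ (λ v → adj G u v ℕ.* deg G v)))
           (≡.trans (sym (Σℚ.*-distribʳ-sum t (λ v → ι (adj G u v)))) (cong (ℚ._* t) (sym (ι-∑ (adj G u))))) ⟩
    ι (∑ (λ v → adj G u v ℕ.* deg G v) (allFin n)) ℚ.+ d ℚ.* t
      ≤⟨ ℚ.+-monoˡ-≤ (d ℚ.* t) (ι-mono-≤ (degree-sum u)) ⟩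
    ι (j ℕ.* deg G u ℕ.+ c) ℚ.+ d ℚ.* t
      ≡⟨ cong (ℚ._+ d ℚ.* t) (≡.trans (ι-+ (j ℕ.* deg G u) c) (cong (ℚ._+ ι c) (ι-* j (deg G u)))) ⟩
    ι j ℚ.* d ℚ.+ ι c ℚ.+ d ℚ.* t
      ≤⟨ ℚ.+-monoˡ-≤ (d ℚ.* t) (ℚ.+-monoʳ-≤ (ι j ℚ.* d) c≤) ⟩
    ι j ℚ.* d ℚ.+ (ι j ℚ.+ t) ℚ.* t ℚ.+ d ℚ.* t
      ≡⟨ solve 3 (λ j d t → j :* d :+ (j :+ t) :* t :+ d :* t := (j :+ t) :* (d :+ t)) refl (ι j) d t ⟩
    (ι j ℚ.+ t) ℚ.* (d ℚ.+ t) ∎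
    where
    open ℚ.≤-Reasoning
    open ℚ.+-*-Solver
    d = ι (deg G u)

-- The ideal choice is t = y - c: then d + t = c + y and (d + t)t = y² - c², which is q - c² ≥ p. As
-- `y` is only a real, a rational `t` slightly above is taken, and the strict gap below `μ` leaves
-- room for `δ`.
above-root : ∀ {c d p q} (y μ : ℝ) → c ℚ.+ c ≡ d → 0ℚ ℚ.≤ c → 0ℚ ℚ.≤ p → p ℚ.+ c ℚ.* c ℚ.≤ q →
  0ℝ ≤ y → y * y ≈ fromℚ q → fromℚ c + y < μ →
  ∃₂ λ t δ → 0ℚ ℚ.< t × 0ℚ ℚ.< δ × p ℚ.≤ (d ℚ.+ t) ℚ.* t ×
    ∃ λ M → ∀ m → M ℕ.≤ m → d ℚ.+ t ℚ.+ δ ℚ.≤ seq μ m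
above-root {c} {p = p} {q} y μ refl 0≤c 0≤p p+c²≤q 0≤y y²≈q (ε , 0<ε , L , gap) =
  from-θ (divide 0<ε (ℚ.positive⁻¹ (ι 8)))
  where
  Goal : Set
  Goal = ∃₂ λ t δ → 0ℚ ℚ.< t × 0ℚ ℚ.< δ × p ℚ.≤ (c ℚ.+ c ℚ.+ t) ℚ.* t ×
    ∃ λ M → ∀ m → M ℕ.≤ m → c ℚ.+ c ℚ.+ t ℚ.+ δ ℚ.≤ seq μ m
  -- With ε = 8θ and s a late term of y, take t = s + 4θ - c: then (s + 4θ)² > q, while the terms of
  -- μ eventually exceed c + (s - 3θ) + 8θ = c + s + 5θ.
  from-θ : (∃ λ θ → 0ℚ ℚ.< θ × θ ℚ.* ι 8 ≡ ε) → Goal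
  from-θ (θ , 0<θ , θ*8≡ε) = from-N (0≤y θ 0<θ)
    -- The tolerance 8θ² fits because (s + 4θ)² - s² = 8θ² + 8θ(s + θ), and s + θ > 0.
    (y²≈q (ι 8 ℚ.* (θ ℚ.* θ)) (0<p*q (ℚ.positive⁻¹ (ι 8)) (0<p*q 0<θ 0<θ)))
    (cauchy y (ι 3 ℚ.* θ) (0<p*q (ℚ.positive⁻¹ (ι 3)) 0<θ))
    where
    from-N : (∃ λ N → ∀ m → N ℕ.≤ m → 0ℚ ℚ.< seq y m ℚ.+ θ) →
             (∃ λ N → ∀ m → N ℕ.≤ m → ∣ seq y m ℚ.* seq y m ℚ.- q ∣ ℚ.< ι 8 ℚ.* (θ ℚ.* θ)) →
             (∃ λ N → ∀ m m′ → N ℕ.≤ m → N ℕ.≤ m′ → ∣ seq y m ℚ.- seq y m′ ∣ ℚ.< ι 3 ℚ.* θ) → Goal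
    from-N (N₁ , h₁) (N₂ , h₂) (N₃ , h₃) = t , θ , 0<t , 0<θ , ℚ.<⇒≤ p<ρt , N₃ ℕ.⊔ L , below
      where
      open ℚ.≤-Reasoning
      open ℚ.+-*-Solver
      M = N₁ ℕ.⊔ N₂ ℕ.⊔ N₃
      s = seq y M
      σ = s ℚ.+ ι 4 ℚ.* θ
      t = σ ℚ.- c
      ρ = c ℚ.+ c ℚ.+ t
      N₁≤M : N₁ ℕ.≤ M
      N₁≤M = ℕ.≤-trans (ℕ.m≤m⊔n N₁ N₂) (ℕ.m≤m⊔n (N₁ ℕ.⊔ N₂) N₃)
      N₂≤M : N₂ ℕ.≤ M
      N₂≤M = ℕ.≤-trans (ℕ.m≤n⊔m N₁ N₂) (ℕ.m≤m⊔n (N₁ ℕ.⊔ N₂) N₃)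
      0<s+θ : 0ℚ ℚ.< s ℚ.+ θ
      0<s+θ = h₁ M N₁≤M
      0<3θ : 0ℚ ℚ.< ι 3 ℚ.* θ
      0<3θ = 0<p*q (ℚ.positive⁻¹ (ι 3)) 0<θ
      q<σ² : q ℚ.< σ ℚ.* σ
      q<σ² = begin-strict
        q
          ≡⟨ solve 2 (λ z q → q := z :+ (:- (z :- q))) refl (s ℚ.* s) q ⟩
        s ℚ.* s ℚ.+ ℚ.- (s ℚ.* s ℚ.- q)
          ≤⟨ ℚ.+-monoʳ-≤ (s ℚ.* s) (ℚ.≤-trans (p≤∣p∣ _) (ℚ.≤-reflexive (ℚ.∣-p∣≡∣p∣ (s ℚ.* s ℚ.- q)))) ⟩
        s ℚ.* s ℚ.+ ∣ s ℚ.* s ℚ.- q ∣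
          <⟨ ℚ.+-monoʳ-< (s ℚ.* s) (h₂ M N₂≤M) ⟩
        s ℚ.* s ℚ.+ ι 8 ℚ.* (θ ℚ.* θ)
          ≡⟨ ℚ.+-identityʳ _ ⟨
        s ℚ.* s ℚ.+ ι 8 ℚ.* (θ ℚ.* θ) ℚ.+ 0ℚ
          <⟨ ℚ.+-monoʳ-< (s ℚ.* s ℚ.+ ι 8 ℚ.* (θ ℚ.* θ)) (0<p*q (0<p*q (ℚ.positive⁻¹ (ι 8)) 0<θ) 0<s+θ) ⟩
        s ℚ.* s ℚ.+ ι 8 ℚ.* (θ ℚ.* θ) ℚ.+ ι 8 ℚ.* θ ℚ.* (s ℚ.+ θ)
          ≡⟨ solve 2 (λ s θ → s :* s :+ con (ι 8) :* (θ :* θ) :+ con (ι 8) :* θ :* (s :+ θ) :=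
                              (s :+ con (ι 4) :* θ) :* (s :+ con (ι 4) :* θ)) refl s θ ⟩
        σ ℚ.* σ ∎
      p<ρt : p ℚ.< ρ ℚ.* t
      p<ρt = +-cancelˡ-< (c ℚ.* c) (begin-strict
        c ℚ.* c ℚ.+ p        ≡⟨ ℚ.+-comm (c ℚ.* c) p ⟩
        p ℚ.+ c ℚ.* c        ≤⟨ p+c²≤q ⟩
        q                    <⟨ q<σ² ⟩
        σ ℚ.* σ              ≡⟨ solve 2 (λ c σ → σ :* σ := c :* c :+ (c :+ c :+ (σ :- c)) :* (σ :- c)) refl c σ ⟩
        c ℚ.* c ℚ.+ ρ ℚ.* t  ∎)
      0≤ρ : 0ℚ ℚ.≤ ρ
      0≤ρ = begin
        0ℚ                                  ≤⟨ ℚ.+-mono-≤ 0≤c (ℚ.+-mono-≤ (ℚ.<⇒≤ 0<s+θ) (ℚ.<⇒≤ 0<3θ)) ⟩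
        c ℚ.+ (s ℚ.+ θ ℚ.+ ι 3 ℚ.* θ)
          ≡⟨ solve 3 (λ c s θ → c :+ (s :+ θ :+ con (ι 3) :* θ) := c :+ c :+ (s :+ con (ι 4) :* θ :- c)) refl c s θ ⟩
        ρ                                   ∎
      0<t : 0ℚ ℚ.< t
      -- As `t` is a difference, its sign is read off from ρt > p ≥ 0 and ρ ≥ 0.
      0<t = ℚ.*-cancelˡ-<-nonNeg ρ {{nonNegative 0≤ρ}}
        (subst (ℚ._< ρ ℚ.* t) (sym (ℚ.*-zeroʳ ρ)) (ℚ.≤-<-trans 0≤p p<ρt))
      below : ∀ m → N₃ ℕ.⊔ L ℕ.≤ m → ρ ℚ.+ θ ℚ.≤ seq μ m
      below m le = begin
        ρ ℚ.+ θ
          ≡⟨ solve 4 (λ c s s′ θ → c :+ c :+ (s :+ con (ι 4) :* θ :- c) :+ θ :=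
                                   c :+ s′ :+ con (ι 5) :* θ :+ (s :- s′)) refl c s s′ θ ⟩
        c ℚ.+ s′ ℚ.+ ι 5 ℚ.* θ ℚ.+ (s ℚ.- s′)
          ≤⟨ ℚ.+-monoʳ-≤ (c ℚ.+ s′ ℚ.+ ι 5 ℚ.* θ) (ℚ.≤-trans (p≤∣p∣ (s ℚ.- s′))
               (ℚ.<⇒≤ (h₃ M m (ℕ.m≤n⊔m (N₁ ℕ.⊔ N₂) N₃) (ℕ.m⊔n≤o⇒m≤o N₃ L le)))) ⟩
        c ℚ.+ s′ ℚ.+ ι 5 ℚ.* θ ℚ.+ ι 3 ℚ.* θ
          ≡⟨ solve 3 (λ c s′ θ → c :+ s′ :+ con (ι 5) :* θ :+ con (ι 3) :* θ := c :+ s′ :+ θ :* con (ι 8)) refl c s′ θ ⟩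
        c ℚ.+ s′ ℚ.+ θ ℚ.* ι 8
          ≡⟨ cong (c ℚ.+ s′ ℚ.+_) θ*8≡ε ⟩
        c ℚ.+ s′ ℚ.+ ε
          ≤⟨ ℚ.<⇒≤ (gap m (ℕ.m⊔n≤o⇒n≤o N₃ L le)) ⟩
        seq μ m ∎
        where s′ = seq y m

-- The constants of the theorem, and the conclusion.

halves : ∀ j → (+ suc j ℤ.- + 1) / 2 ℚ.+ (+ suc j ℤ.- + 1) / 2 ≡ ι j
-- `+ suc j - + 1` computes to `+ j`, so the quotient is `+ j / 2` by definition.
halves j = ≡.trans (solve 1 (λ h → h :+ h := con (ι 2) :* h) refl (+ j / 2)) (ι-*-/ j 1)
  where open ℚ.+-*-Solver

half²≤quarter : ∀ j {m} → j ℕ.* j ℕ.≤ m →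
  (+ suc j ℤ.- + 1) / 2 ℚ.* ((+ suc j ℤ.- + 1) / 2) ℚ.≤ + m / 4
half²≤quarter j {m} le = ℚ.*-cancelˡ-≤-pos (ι 4) (begin
  ι 4 ℚ.* (h ℚ.* h)        ≡⟨ solve 1 (λ h → con (ι 4) :* (h :* h) := (con (ι 2) :* h) :* (con (ι 2) :* h)) refl h ⟩
  ι 2 ℚ.* h ℚ.* (ι 2 ℚ.* h) ≡⟨ cong₂ ℚ._*_ (ι-*-/ j 1) (ι-*-/ j 1) ⟩
  ι j ℚ.* ι j              ≡⟨ ι-* j j ⟨
  ι (j ℕ.* j)              ≤⟨ ι-mono-≤ le ⟩
  ι m                      ≡⟨ ι-*-/ m 3 ⟨
  ι 4 ℚ.* (+ m / 4)        ∎)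
  where
  open ℚ.≤-Reasoning
  open ℚ.+-*-Solver
  h = + j / 2

-- Searching the finitely many indices makes the choice between a cycle and degree bounds at all
-- vertices constructive.
all-or-one : ∀ {n} {P : Set} {Q : Fin n → Set} → (∀ i → P ⊎ Q i) → P ⊎ (∀ i → Q i)
all-or-one {zero}  h = inj₂ λ ()
all-or-one {suc n} h with h zero | all-or-one (λ i → h (suc i))
... | inj₁ p | _      = inj₁ p
... | inj₂ _ | inj₁ p = inj₁ p
... | inj₂ q | inj₂ r = inj₂ λ where
  zero    → q
  (suc i) → r i

-- `above-root` supplies `t` with ρ = j + t below `μ`; `weight G t` is then superharmonic for ρ, and
-- every solution of the eigenvalue equation vanishes. In the application c is kn and h is (k -
-- 1)/2.
degree-sum⇒¬eigenvalue : ∀ {n} (G : Graph n) (μ : ℝ) j c h q →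
  (∀ u → ∑ (λ v → adj G u v ℕ.* deg G v) (allFin _) ℕ.≤ j ℕ.* deg G u ℕ.+ c) →
  h ℚ.+ h ≡ ι j → 0ℚ ℚ.≤ h → ι c ℚ.+ h ℚ.* h ℚ.≤ q → μ > fromℚ h + √ q →
  ¬ IsEigenvalue (adjacencyMatrix G) μ
degree-sum⇒¬eigenvalue G μ j c h q degree-sum 2h≡j 0≤h c+h²≤q μ> (x , x≢0 , eigen) =
  x≢0 (vanishes (above-root {h} {ι j} {ι c} {q} (√ q) μ 2h≡j 0≤h (0≤ι c) c+h²≤q (√-nonNegative q) (√-square q 0≤q) μ>))
  where
  0≤q : 0ℚ ℚ.≤ q
  0≤q = ℚ.≤-trans (ℚ.+-mono-≤ (0≤ι c) (0≤p*q 0≤h 0≤h)) c+h²≤q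
  vanishes : (∃₂ λ t δ → 0ℚ ℚ.< t × 0ℚ ℚ.< δ × ι c ℚ.≤ (ι j ℚ.+ t) ℚ.* t ×
    ∃ λ M → ∀ m → M ℕ.≤ m → ι j ℚ.+ t ℚ.+ δ ℚ.≤ seq μ m) → x ≈ᵥ 0ᵥ
  vanishes (t , δ , 0<t , 0<δ , c≤ , M , ≤μ) =
    eigenvector-vanishes {a = λ u w → ι (adj G u w)} {weight G t} {ι j ℚ.+ t}
      (λ u w → 0≤ι (adj G u w)) (λ u w → cong ι (adj-symmetric G u w))
      (λ u → ℚ.≤-trans (ℚ.<⇒≤ 0<t) (t≤weight G t u)) (weight-superharmonic G t j c degree-sum c≤)
      (adjacencyMatrix G) μ x (seq-adjacencyMatrix G) 0<t (t≤weight G t) 0<δ ≤μ eigen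

theorem3 : (k : ℕ) → 1 ℕ.≤ k → (n : ℕ) (G : Graph n) (μ : ℝ) →
    IsLargestEigenvalue (adjacencyMatrix G) μ →
    μ > fromℚ ((+ k ℤ.- + 1) / 2) + √ ((+ (k ℕ.* n)) / 1 ℚ.+ (+ ((k ℕ.+ 1) ℕ.^ 2)) / 4) →
    Contains G (C (2 ℕ.* k ℕ.+ 1)) ⊎ Contains G (C (2 ℕ.* k ℕ.+ 2))
theorem3 (suc j) _ n G μ (eigen , _) μ> =
  conclude (all-or-one {P = Cycle} {Q = DegreeSum} (λ u → cycle-or-degree-sum G u j))
  where
  h q : ℚ
  h = (+ suc j ℤ.- + 1) / 2
  q = (+ (suc j ℕ.* n)) / 1 ℚ.+ (+ ((suc j ℕ.+ 1) ℕ.^ 2)) / 4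
  0≤h : 0ℚ ℚ.≤ h
  0≤h = ℚ.nonNegative⁻¹ (+ j / 2) {{ℚ.normalize-nonNeg j 2}}
  j≤j+2 : j ℕ.≤ suc j ℕ.+ 1
  j≤j+2 = ℕ.≤-trans (ℕ.n≤1+n j) (ℕ.m≤m+n (suc j) 1)
  -- After cancelling kn this compares (k - 1)²/4 with (k + 1)²/4.
  kn+h²≤q : ι (suc j ℕ.* n) ℚ.+ h ℚ.* h ℚ.≤ q
  kn+h²≤q = ℚ.+-monoʳ-≤ (ι (suc j ℕ.* n)) (half²≤quarter j {(suc j ℕ.+ 1) ℕ.^ 2} (ℕ.*-mono-≤ j≤j+2
    (ℕ.≤-trans j≤j+2 (ℕ.≤-reflexive (sym (ℕ.*-identityʳ (suc j ℕ.+ 1)))))))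
  Cycle : Set
  Cycle = Contains G (C (2 ℕ.* suc j ℕ.+ 1)) ⊎ Contains G (C (2 ℕ.* suc j ℕ.+ 2))
  DegreeSum : Fin n → Set
  DegreeSum u = ∑ (λ v → adj G u v ℕ.* deg G v) (allFin n) ℕ.≤ j ℕ.* deg G u ℕ.+ suc j ℕ.* n
  conclude : Cycle ⊎ (∀ u → DegreeSum u) → Cycle
  conclude (inj₁ cycle)      = cycle
  conclude (inj₂ degree-sum) = ⊥-elim
    (degree-sum⇒¬eigenvalue G μ j (suc j ℕ.* n) h q degree-sum (halves j) 0≤h kn+h²≤q μ> eigen)
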